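{- Let $w_1,w_2$ be words in $\mathcal{H}^{2,3}=\mathbb{Z}\langle z_2,z_3\rangle$ (monomials in $z_2,z_3$), and let $Z_{\mathcal{A}}$, $\star$, $\mathrm{wt}$ and the reversal $\overleftarrow{w}$ be as defined in the context. Then, in the ring $\mathcal{A}=\prod_p\mathbb{Z}/p\mathbb{Z}\,\big/\bigoplus_p\mathbb{Z}/p\mathbb{Z}$, \[ (-1)^{\mathrm{wt}(w_2)}Z_{\mathcal{A}}(w_1\overleftarrow{w_2})=Z_{\mathcal{A}}(w_1\star w_2). \]
   Context: **Algebras.** $\mathcal{H}=\mathbb{Z}\langle x,y\rangle$ is the non-commutative polynomial ring over $\mathbb{Z}$ in two variables $x,y$. For each positive integer $k$ put $z_k=yx^{k-1}$. Then $\mathbb{Z}+y\mathcal{H}=\mathbb{Z}\langle z_1,z_2,\dots\rangle$, and $\mathcal{H}^{2,3}=\mathbb{Z}\langle z_2,z_3\rangle$ is a subring of it. A word in $\mathcal{H}^{2,3}$ is a (possibly empty) monomial in $z_2,z_3$. For a word $w=z_{k_1}\cdots z_{k_r}$, put $\overleftarrow{w}=z_{k_r}\cdots z_{k_1}$ and $\mathrm{wt}(w)=k_1+\cdots+k_r$. **The product $\star$.** $\star$ is the $\mathbb{Z}$-bilinear product on $\mathcal{H}^{2,3}$ defined inductively, for words $w,w'$ in $\mathcal{H}^{2,3}$, by - $w\star 1=1\star w=w$; - $wz_2\star w'=w\star w'z_2=(w\star w')z_2$; - $wz_3\star w'z_3=(w\star w'z_3)z_3+(wz_3\star w')z_3+(w\star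 w')z_2^3$. **Finite multiple zeta values.** Let $\mathcal{A}=\prod_p\mathbb{Z}/p\mathbb{Z}\,\big/\bigoplus_p\mathbb{Z}/p\mathbb{Z}$, where $p$ runs over all primes. For positive integers $k_1,\dots,k_r$ and a prime $p$, put \[ \zeta_p(k_1,\dots,k_r)=\sum_{0<n_1<\cdots<n_r<p}\frac{1}{n_1^{k_1}\cdots n_r^{k_r}},\qquad \zeta_{\mathcal{A}}(k_1,\dots,k_r)=(\zeta_p(k_1,\dots,k_r)\bmod p)_p\in\mathcal{A}. \] $Z_{\mathcal{A}}\colon\mathbb{Z}\langle z_1,z_2,\dots\rangle\to\mathcal{A}$ is the $\mathbb{Z}$-linear map with $Z_{\mathcal{A}}(1)=1$ and $Z_{\mathcal{A}}(z_{k_1}\cdots z_{k_r})=\zeta_{\mathcal{A}}(k_1,\dots,k_r)$. -}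

module Defs where

open import Algebra.Bundles using (CommutativeRing)
open import Data.Integer as ℤ using (ℤ; +_; 0ℤ; 1ℤ)
import Data.Integer.Divisibility.Signed as ℤ
import Data.Integer.Properties as ℤ
open import Data.Integer.Tactic.RingSolver using (solve-∀)
open import Data.List
  using (List; []; _∷_; _++_; _∷ʳ_; [_]; map; concatMap; foldr; filter; upTo; length; cartesianProductWith)
open import Data.List.Properties using (∷ʳ-injective; ++-identityʳ)
open import Data.List.Reverse using (Reverse; []; _∶_∶ʳ_; reverseView)
open import Data.Nat as ℕ using (ℕ; zero; suc; NonZero; _⊔_)
open import Data.Nat.Coprimality as Coprime using (Coprime; coprime⇒GCD≡1)
open import Data.Nat.GCD using (GCD; module Bézout)
open import Data.Nat.Primality using (Prime)
open import Data.Nat.ListAction using (sum)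
import Data.Nat.Properties as ℕ
open import Data.Product using (_×_; _,_; ∃-syntax)
open import Data.Vec using (Vec; []; _∷_)
open import Level using (0ℓ)
open import Relation.Binary.PropositionalEquality
  using (_≡_; refl; sym; trans; cong; cong₂; subst; module ≡-Reasoning)

Word : Set → Set
Word X = List X

-- The list (c₁ , w₁) ∷ … ∷ (cₙ , wₙ) ∷ [] stands for c₁w₁ + … + cₙwₙ, so
-- different lists may stand for the same polynomial. They are not compared
-- here: every map out of ℤ⟨ X ⟩ below is a linear extension.
ℤ⟨_⟩ : Set → Set
ℤ⟨ X ⟩ = List (ℤ × Word X)

module _ {X : Set} where

  infixl 6 _⊞_
  infixl 7 _⊠_ _⊙_

  monomial : Word X → ℤ⟨ X ⟩
  monomial w = [ (1ℤ , w) ]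

  _⊞_ : ℤ⟨ X ⟩ → ℤ⟨ X ⟩ → ℤ⟨ X ⟩
  _⊞_ = _++_

  _⊙_ : ℤ → ℤ⟨ X ⟩ → ℤ⟨ X ⟩
  c ⊙ f = map (λ (d , w) → c ℤ.* d , w) f

  _⊠_ : ℤ⟨ X ⟩ → ℤ⟨ X ⟩ → ℤ⟨ X ⟩
  _⊠_ = cartesianProductWith (λ (c , u) (d , v) → c ℤ.* d , u ++ v)

-- z k is yx^{k-1} in ℤ⟨x,y⟩; these generate ℤ + yℤ⟨x,y⟩ freely.
record Letter : Set where
  constructor z
  field
    index       : ℕ
    .{{nonZero}} : NonZero index

open Letter public using (index)

data Letter₂₃ : Set where
  z₂ z₃ : Letter₂₃

letter : Letter₂₃ → Letter
letter z₂ = z 2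
letter z₃ = z 3

𝓗²³ : Set
𝓗²³ = ℤ⟨ Letter₂₃ ⟩

inclusion : 𝓗²³ → ℤ⟨ Letter ⟩
inclusion = map (λ (c , w) → c , map letter w)

wt : Word Letter₂₃ → ℕ
wt w = sum (map (λ a → index (letter a)) w)

-- Recursion on last letters. When both words end in z₂ the two readings of
-- the second rule overlap; the clauses strip the left word first, and
-- ⋆ʷ-z₂ˡ, ⋆ʷ-z₂ʳ below show that both readings hold.
star : {w w′ : Word Letter₂₃} → Reverse w → Reverse w′ → 𝓗²³
star {_} {w′} []              _                 = monomial w′
star {w} {_}  (_ ∶ _ ∶ʳ _)    []                = monomial w
star          (_ ∶ r ∶ʳ z₂)   r′@(_ ∶ _ ∶ʳ _)   = star r r′ ⊠ monomial [ z₂ ]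
star          r@(_ ∶ _ ∶ʳ z₃) (_ ∶ r′ ∶ʳ z₂)    = star r r′ ⊠ monomial [ z₂ ]
star          r₃@(_ ∶ r ∶ʳ z₃) r′₃@(_ ∶ r′ ∶ʳ z₃) =
    star r r′₃ ⊠ monomial [ z₃ ]
  ⊞ star r₃ r′ ⊠ monomial [ z₃ ]
  ⊞ star r r′  ⊠ monomial (z₂ ∷ z₂ ∷ z₂ ∷ [])

infixl 7 _⋆ʷ_ _⋆_

_⋆ʷ_ : Word Letter₂₃ → Word Letter₂₃ → 𝓗²³
w ⋆ʷ w′ = star (reverseView w) (reverseView w′)

_⋆_ : 𝓗²³ → 𝓗²³ → 𝓗²³
f ⋆ g = concatMap (λ (c , w) → concatMap (λ (d , w′) → (c ℤ.* d) ⊙ (w ⋆ʷ w′)) g) f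

private
  []≢∷ʳ : {A B : Set} {xs : List A} {x : A} → [] ≡ xs ∷ʳ x → B
  []≢∷ʳ {xs = []}    ()
  []≢∷ʳ {xs = _ ∷ _} ()

  view-unique′ : {A : Set} {xs ys : List A} (r : Reverse xs) (s : Reverse ys)
                 (eq : xs ≡ ys) → subst Reverse eq r ≡ s
  view-unique′ []             []             refl = refl
  view-unique′ []             (_ ∶ _ ∶ʳ _)   eq   = []≢∷ʳ eq
  view-unique′ (_ ∶ _ ∶ʳ _)   []             eq   = []≢∷ʳ (sym eq)
  view-unique′ (xs ∶ r ∶ʳ x)  (ys ∶ s ∶ʳ y)  eq with ∷ʳ-injective xs ys eq
  ... | refl , refl with refl ← eq = cong (λ t → xs ∶ t ∶ʳ x) (view-unique′ r s refl)

  view-∷ʳ : {A : Set} (xs : List A) (x : A) →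
            reverseView (xs ∷ʳ x) ≡ xs ∶ reverseView xs ∶ʳ x
  view-∷ʳ xs x = view-unique′ (reverseView (xs ∷ʳ x)) (xs ∶ reverseView xs ∶ʳ x) refl

  star-[]ʳ : {w : Word Letter₂₃} (r : Reverse w) → star r [] ≡ monomial w
  star-[]ʳ []           = refl
  star-[]ʳ (_ ∶ _ ∶ʳ _) = refl

  star-z₂ˡ : ∀ {w w′} (r : Reverse w) (r′ : Reverse w′) →
             star (w ∶ r ∶ʳ z₂) r′ ≡ star r r′ ⊠ monomial [ z₂ ]
  star-z₂ˡ r []             rewrite star-[]ʳ r = refl
  star-z₂ˡ r (_ ∶ _ ∶ʳ _) = refl

  star-z₂ʳ : ∀ {w w′} (r : Reverse w) (r′ : Reverse w′) →
             star r (w′ ∶ r′ ∶ʳ z₂) ≡ star r r′ ⊠ monomial [ z₂ ]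
  star-z₂ʳ []             r′ = refl
  star-z₂ʳ (w ∶ r ∶ʳ z₂)  r′ = cong (_⊠ monomial [ z₂ ])
    (trans (star-z₂ʳ r r′) (sym (star-z₂ˡ r r′)))
  star-z₂ʳ (w ∶ r ∶ʳ z₃)  r′ = refl

⋆ʷ-identityˡ : ∀ w → [] ⋆ʷ w ≡ monomial w
⋆ʷ-identityˡ w = refl

⋆ʷ-identityʳ : ∀ w → w ⋆ʷ [] ≡ monomial w
⋆ʷ-identityʳ w = star-[]ʳ (reverseView w)

⋆ʷ-z₂ˡ : ∀ w w′ → (w ∷ʳ z₂) ⋆ʷ w′ ≡ (w ⋆ʷ w′) ⊠ monomial [ z₂ ]
⋆ʷ-z₂ˡ w w′ rewrite view-∷ʳ w z₂ = star-z₂ˡ (reverseView w) (reverseView w′)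

⋆ʷ-z₂ʳ : ∀ w w′ → w ⋆ʷ (w′ ∷ʳ z₂) ≡ (w ⋆ʷ w′) ⊠ monomial [ z₂ ]
⋆ʷ-z₂ʳ w w′ rewrite view-∷ʳ w′ z₂ = star-z₂ʳ (reverseView w) (reverseView w′)

⋆ʷ-z₃ : ∀ w w′ → (w ∷ʳ z₃) ⋆ʷ (w′ ∷ʳ z₃) ≡
    (w ⋆ʷ (w′ ∷ʳ z₃)) ⊠ monomial [ z₃ ]
  ⊞ ((w ∷ʳ z₃) ⋆ʷ w′) ⊠ monomial [ z₃ ]
  ⊞ (w ⋆ʷ w′) ⊠ monomial (z₂ ∷ z₂ ∷ z₂ ∷ [])
⋆ʷ-z₃ w w′ rewrite view-∷ʳ w z₃ | view-∷ʳ w′ z₃ = refl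

⋆-monomial : ∀ w w′ → monomial w ⋆ monomial w′ ≡ w ⋆ʷ w′
⋆-monomial w w′ = begin
  (1ℤ ⊙ (w ⋆ʷ w′) ++ []) ++ []  ≡⟨ ++-identityʳ _ ⟩
  1ℤ ⊙ (w ⋆ʷ w′) ++ []          ≡⟨ ++-identityʳ _ ⟩
  1ℤ ⊙ (w ⋆ʷ w′)                ≡⟨ 1⊙ (w ⋆ʷ w′) ⟩
  w ⋆ʷ w′                       ∎
  where
  open ≡-Reasoning
  1⊙ : (f : 𝓗²³) → 1ℤ ⊙ f ≡ f
  1⊙ []            = refl
  1⊙ ((c , w) ∷ f) = cong₂ _∷_ (cong (_, w) (ℤ.*-identityˡ c)) (1⊙ f)

infix 4 _≡_[mod_]

_≡_[mod_] : ℤ → ℤ → ℕ → Set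
a ≡ b [mod p ] = + p ℤ.∣ a ℤ.- b

-- Representatives of elements of ∏ ℤ/p. The primality proof is irrelevant,
-- so that there is exactly one component for each prime.
Family : Set
Family = (p : ℕ) → .(Prime p) → ℤ

-- Equality of classes modulo ⨁ ℤ/p: all but finitely many components, i.e.
-- all those beyond some bound, are congruent.
infix 4 _≈_

_≈_ : Family → Family → Set
a ≈ b = ∃[ N ] ∀ p → (pr : Prime p) → N ℕ.< p → a p pr ≡ b p pr [mod p ]

infix  8 -ᶠ_
infixl 7 _*ᶠ_
infixl 6 _+ᶠ_

_+ᶠ_ _*ᶠ_ : Family → Family → Family
(a +ᶠ b) p pr = a p pr ℤ.+ b p pr
(a *ᶠ b) p pr = a p pr ℤ.* b p pr

-ᶠ_ : Family → Family
(-ᶠ a) p pr = ℤ.- a p pr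

constant : ℤ → Family
constant c _ _ = c

private
  equal⇒mod : ∀ {a b} (p : ℕ) → a ≡ b → a ≡ b [mod p ]
  equal⇒mod {a} p refl = ℤ.divides 0ℤ (ℤ.+-inverseʳ a)

  pointwise : (a b : Family) → (∀ p → (pr : Prime p) → a p pr ≡ b p pr) → a ≈ b
  pointwise _ _ h = 0 , λ p pr _ → equal⇒mod p (h p pr)

  lift₁ : (a b a′ b′ : Family) →
          (∀ p (pr : Prime p) → a p pr ≡ b p pr [mod p ] → a′ p pr ≡ b′ p pr [mod p ]) →
          a ≈ b → a′ ≈ b′
  lift₁ _ _ _ _ f (N , h) = N , λ p pr N<p → f p pr (h p pr N<p)

  lift₂ : (a b c d a′ b′ : Family) →
          (∀ p (pr : Prime p) → a p pr ≡ b p pr [mod p ] → c p pr ≡ d p pr [mod p ] →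
             a′ p pr ≡ b′ p pr [mod p ]) →
          a ≈ b → c ≈ d → a′ ≈ b′
  lift₂ _ _ _ _ _ _ f (N , h) (M , k) = N ⊔ M , λ p pr <p →
    f p pr (h p pr (ℕ.≤-<-trans (ℕ.m≤m⊔n N M) <p)) (k p pr (ℕ.≤-<-trans (ℕ.m≤n⊔m N M) <p))

  sym-id : ∀ a b → ℤ.- (a ℤ.- b) ≡ b ℤ.- a
  sym-id = solve-∀

  trans-id : ∀ a b c → (a ℤ.- b) ℤ.+ (b ℤ.- c) ≡ a ℤ.- c
  trans-id = solve-∀

  +-id : ∀ a b c d → (a ℤ.- b) ℤ.+ (c ℤ.- d) ≡ (a ℤ.+ c) ℤ.- (b ℤ.+ d)
  +-id = solve-∀

  *-id : ∀ a b c d → (a ℤ.- b) ℤ.* c ℤ.+ b ℤ.* (c ℤ.- d) ≡ a ℤ.* c ℤ.- b ℤ.* d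
  *-id = solve-∀

  neg-id : ∀ a b → ℤ.- (a ℤ.- b) ≡ ℤ.- a ℤ.- ℤ.- b
  neg-id = solve-∀

𝒜 : CommutativeRing 0ℓ 0ℓ
𝒜 = record
  { Carrier = Family
  ; _≈_ = _≈_
  ; _+_ = _+ᶠ_
  ; _*_ = _*ᶠ_
  ; -_  = -ᶠ_
  ; 0#  = constant 0ℤ
  ; 1#  = constant 1ℤ
  ; isCommutativeRing = record
    { isRing = record
      { +-isAbelianGroup = record
        { isGroup = record
          { isMonoid = record
            { isSemigroup = record
              { isMagma = record
                { isEquivalence = record
                  { refl = λ {a} → pointwise a a λ _ _ → refl
                  ; sym = λ {a} {b} → lift₁ a b b a λ p pr h →
                      subst (+ p ℤ.∣_) (sym-id (a p pr) (b p pr)) (ℤ.∣m⇒∣-m h)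
                  ; trans = λ {a} {b} {c} → lift₂ a b b c a c λ p pr h k →
                      subst (+ p ℤ.∣_) (trans-id (a p pr) (b p pr) (c p pr)) (ℤ.∣m∣n⇒∣m+n h k)
                  }
                ; ∙-cong = λ {a} {b} {c} {d} → lift₂ a b c d (a +ᶠ c) (b +ᶠ d) λ p pr h k →
                    subst (+ p ℤ.∣_) (+-id (a p pr) (b p pr) (c p pr) (d p pr))
                      (ℤ.∣m∣n⇒∣m+n h k)
                }
              ; assoc = λ a b c → pointwise _ _ λ p pr → ℤ.+-assoc (a p pr) (b p pr) (c p pr)
              }
            ; identity = (λ a → pointwise _ _ λ p pr → ℤ.+-identityˡ (a p pr))
                       , (λ a → pointwise _ _ λ p pr → ℤ.+-identityʳ (a p pr))
            }
          ; inverse = (λ a → pointwise _ _ λ p pr → ℤ.+-inverseˡ (a p pr))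
                    , (λ a → pointwise _ _ λ p pr → ℤ.+-inverseʳ (a p pr))
          ; ⁻¹-cong = λ {a} {b} → lift₁ a b (-ᶠ a) (-ᶠ b) λ p pr h →
              subst (+ p ℤ.∣_) (neg-id (a p pr) (b p pr)) (ℤ.∣m⇒∣-m h)
          }
        ; comm = λ a b → pointwise _ _ λ p pr → ℤ.+-comm (a p pr) (b p pr)
        }
      ; *-cong = λ {a} {b} {c} {d} → lift₂ a b c d (a *ᶠ c) (b *ᶠ d) λ p pr h k →
          subst (+ p ℤ.∣_) (*-id (a p pr) (b p pr) (c p pr) (d p pr))
            (ℤ.∣m∣n⇒∣m+n (ℤ.∣m⇒∣m*n (c p pr) h) (ℤ.∣n⇒∣m*n (b p pr) k))
      ; *-assoc = λ a b c → pointwise _ _ λ p pr → ℤ.*-assoc (a p pr) (b p pr) (c p pr)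
      ; *-identity = (λ a → pointwise _ _ λ p pr → ℤ.*-identityˡ (a p pr))
                   , (λ a → pointwise _ _ λ p pr → ℤ.*-identityʳ (a p pr))
      ; distrib = (λ a b c → pointwise _ _ λ p pr → ℤ.*-distribˡ-+ (a p pr) (b p pr) (c p pr))
                , (λ a b c → pointwise _ _ λ p pr → ℤ.*-distribʳ-+ (a p pr) (b p pr) (c p pr))
      }
    ; *-comm = λ a b → pointwise _ _ λ p pr → ℤ.*-comm (a p pr) (b p pr)
    }
  }

-- A representative of 1/n in ℤ/p, read off from Bézout's identity
-- gcd(n,p) = xn - yp or gcd(n,p) = yp - xn; a junk value if n and p are not
-- coprime.
recip : (p n : ℕ) → ℤ
recip p n with Bézout.lemma n p
... | Bézout.result _ _ (Bézout.+- x _ _) = + x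
... | Bézout.result _ _ (Bézout.-+ x _ _) = ℤ.- (+ x)

recip-correct : ∀ {p n} → Coprime n p → + n ℤ.* recip p n ≡ 1ℤ [mod p ]
recip-correct {p} {n} c with Bézout.lemma n p
... | Bézout.result d g b with GCD.unique g (coprime⇒GCD≡1 c)
recip-correct {p} {n} c | Bézout.result _ _ (Bézout.+- x y eq) | refl =
  ℤ.divides (+ y) (begin
    + n ℤ.* + x ℤ.- 1ℤ                  ≡⟨ cong (ℤ._- 1ℤ) (ℤ.*-comm (+ n) (+ x)) ⟩
    + x ℤ.* + n ℤ.- 1ℤ                  ≡⟨ cong (ℤ._- 1ℤ) (ℤ.pos-* x n) ⟨
    + (x ℕ.* n) ℤ.- 1ℤ                  ≡⟨ cong (λ t → + t ℤ.- 1ℤ) eq ⟨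
    (1ℤ ℤ.+ + (y ℕ.* p)) ℤ.- 1ℤ         ≡⟨ cancel (+ (y ℕ.* p)) ⟩
    + (y ℕ.* p)                         ≡⟨ ℤ.pos-* y p ⟩
    + y ℤ.* + p                         ∎)
  where
  open ≡-Reasoning
  cancel : ∀ t → (1ℤ ℤ.+ t) ℤ.- 1ℤ ≡ t
  cancel = solve-∀
recip-correct {p} {n} c | Bézout.result _ _ (Bézout.-+ x y eq) | refl =
  ℤ.divides (ℤ.- (+ y)) (begin
    + n ℤ.* ℤ.- (+ x) ℤ.- 1ℤ            ≡⟨ rearrange (+ n) (+ x) ⟩
    ℤ.- (1ℤ ℤ.+ + x ℤ.* + n)            ≡⟨ cong (λ t → ℤ.- (1ℤ ℤ.+ t)) (ℤ.pos-* x n) ⟨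
    ℤ.- (+ (1 ℕ.+ x ℕ.* n))             ≡⟨ cong (λ t → ℤ.- (+ t)) eq ⟩
    ℤ.- (+ (y ℕ.* p))                   ≡⟨ cong ℤ.-_ (ℤ.pos-* y p) ⟩
    ℤ.- (+ y ℤ.* + p)                   ≡⟨ ℤ.neg-distribˡ-* (+ y) (+ p) ⟩
    ℤ.- (+ y) ℤ.* + p                   ∎)
  where
  open ≡-Reasoning
  rearrange : ∀ a b → a ℤ.* ℤ.- b ℤ.- 1ℤ ≡ ℤ.- (1ℤ ℤ.+ b ℤ.* a)
  rearrange = solve-∀

-- All (n₁ , … , nᵣ) with a < n₁ < ⋯ < nᵣ < b.
increasing : (a b r : ℕ) → List (Vec ℕ r)
increasing a b zero    = [ [] ]
increasing a b (suc r) =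
  concatMap (λ n → map (n ∷_) (increasing n b r)) (filter (a ℕ.<?_) (upTo b))

-- The word z_{k₁} ⋯ z_{kᵣ} also serves as the index (k₁ , … , kᵣ).
denominator : (w : Word Letter) → Vec ℕ (length w) → ℕ
denominator []      []       = 1
denominator (a ∷ w) (n ∷ ns) = n ℕ.^ index a ℕ.* denominator w ns

ζₚ : ℕ → Word Letter → ℤ
ζₚ p w = foldr ℤ._+_ 0ℤ (map (λ ns → recip p (denominator w ns)) (increasing 0 p (length w)))

ζ𝒜 : Word Letter → Family
ζ𝒜 w p _ = ζₚ p w

Z𝒜 : ℤ⟨ Letter ⟩ → Family
Z𝒜 = foldr (λ (c , w) a → constant c * ζ𝒜 w + a) 0#
  where open CommutativeRing 𝒜 using (_+_; _*_; 0#)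

Z𝒜-1 : Z𝒜 (monomial []) ≈ CommutativeRing.1# 𝒜
Z𝒜-1 = 0 , λ p _ _ →
  subst (+ p ℤ.∣_) (cong (ℤ._- 1ℤ) (sym (unit (recip p 1)))) (recip-correct (Coprime.1-coprimeTo p))
  where
  unit : ∀ t → 1ℤ ℤ.* (t ℤ.+ 0ℤ) ℤ.+ 0ℤ ≡ 1ℤ ℤ.* t
  unit = solve-∀

{-# OPTIONS --safe #-}

-- Let p be a prime and N = p - 1. For words w, w′ and l ≤ N, consider the
-- connected sum
--   F(w,w′)(l) = ∑ C(nᵣ,mₛ;l) / (n₁^k₁ ⋯ nᵣ^kᵣ m₁^k′₁ ⋯ mₛ^k′ₛ)
-- over 0 < n₁ < ⋯ < nᵣ ≤ N and 0 < m₁ < ⋯ < mₛ ≤ N, with the connector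
--   C(n,m;l) = n! m! (l-n)! (l-m)! / ((n+m)! l! (l-n-m)!),
-- which vanishes for l < n + m. Write δC = C(n,m;l) - C(n,m;l-1). The relations
--   l² δC = n² (C(n-1,m;l-1) - C(n,m;l-1)) = m² (C(n,m-1;l-1) - C(n,m;l-1)),
--   l (l-n-m) δC = nm C(n,m;l-1)
-- show, after telescoping, that l ↦ F(w,w′)(l) obeys the recursion defining ⋆,
-- where multiplication by z_k on the right turns into ψ ↦ ∑_{0 < l′ ≤ l} ψ(l′-1)/l′^k.
-- Hence F(w,w′)(N) represents Z(w ⋆ w′) mod p. On the other hand C(n,m;N) ≡ 1 mod p if
-- n + m < p, so that the substitution m ↦ p - m turns F(w,w′)(N) into
-- (-1)^wt(w′) times the sum for w followed by the reversal of w′.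
module Submission where

open import Defs
open import Algebra.Bundles using (CommutativeRing)
open import Data.Integer as ℤ using (ℤ; +_; 0ℤ; 1ℤ; -1ℤ)
import Data.Integer.Divisibility.Signed as ℤ
import Data.Integer.Properties as ℤ
open import Data.Integer.Tactic.RingSolver using (solve-∀)
open import Data.List
  using (List; []; _∷_; _∷ʳ_; [_]; concatMap; filter; foldl; foldr; length; map; upTo)
open import Data.List using (_++_; reverse)
open import Data.List.Properties
  using (++-identityʳ; ∷ʳ-++; filter-++; filter-accept; filter-none; foldr-++; foldr-map; foldr-∷ʳ;
         map-++; map-∘; reverse-++; upTo-∷ʳ)
open import Data.List.Relation.Unary.All as All using (All; []; _∷_)
open import Data.List.Relation.Unary.All.Properties
  using (all-filter; all-upTo; concat⁺; filter⁺; map⁺)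
open import Data.List.Reverse using (Reverse; []; _∶_∶ʳ_; reverseView)
open import Data.Nat as ℕ using (ℕ; zero; suc; _∸_; _≤_; _<_; z≤n; s≤s)
open import Data.Nat.Coprimality as Coprime
  using (Coprime; 1-coprimeTo; coprime-divisor; prime⇒coprime)
open import Data.Nat.Divisibility using (∣-trans)
open import Data.Nat.ListAction using (sum)
open import Data.Nat.ListAction.Properties using (sum-++)
open import Data.Nat.Primality using (Prime; ¬prime[0])
import Data.Nat.Properties as ℕ
open import Data.Product using (_×_; _,_)
open import Data.Sum using (inj₁; inj₂)
open import Data.Vec using (_∷_)
open import Relation.Binary.Bundles using (Setoid)
open import Relation.Binary.PropositionalEquality as ≡ using (_≡_; refl; cong; cong₂; subst)
import Relation.Binary.Reasoning.Setoid as SetoidReasoning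
open import Relation.Nullary using (contradiction)

module Development where

  open import Data.Integer using (_+_; _*_; _-_; -_; _^_)

  -- Congruences modulo p.

  module Congruence (p : ℕ) where

    infix 4 _~_

    -- A record, unlike _≡_[mod_], lets Agda recover a and b from a proof.
    record _~_ (a b : ℤ) : Set where
      constructor ⌊_⌋
      field congruent : a ≡ b [mod p ]

    open _~_ public

    -- Serves proofs by certificate: the difference of the two sides is written as a combination of
    -- differences known to be divisible by p, and the ring solver checks this integer identity.
    combine : ∀ {a b x y} c → x ~ y → a - b ≡ c * (x - y) → a ~ b
    combine c ⌊ h ⌋ eq = ⌊ subst (+ p ℤ.∣_) (≡.sym eq) (ℤ.∣n⇒∣m*n c h) ⌋

    combine₂ : ∀ {a b x y x′ y′} c → x ~ y → ∀ d → x′ ~ y′ →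
               a - b ≡ c * (x - y) + d * (x′ - y′) → a ~ b
    combine₂ c ⌊ h ⌋ d ⌊ k ⌋ eq =
      ⌊ subst (+ p ℤ.∣_) (≡.sym eq) (ℤ.∣m∣n⇒∣m+n (ℤ.∣n⇒∣m*n c h) (ℤ.∣n⇒∣m*n d k)) ⌋

    combine₃ : ∀ {a b x y x′ y′ x″ y″} c → x ~ y → ∀ d → x′ ~ y′ → ∀ e → x″ ~ y″ →
               a - b ≡ c * (x - y) + d * (x′ - y′) + e * (x″ - y″) → a ~ b
    combine₃ c ⌊ h ⌋ d ⌊ k ⌋ e ⌊ l ⌋ eq =
      ⌊ subst (+ p ℤ.∣_) (≡.sym eq)
          (ℤ.∣m∣n⇒∣m+n (ℤ.∣m∣n⇒∣m+n (ℤ.∣n⇒∣m*n c h) (ℤ.∣n⇒∣m*n d k)) (ℤ.∣n⇒∣m*n e l)) ⌋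

    ~-reflexive : ∀ {a b} → a ≡ b → a ~ b
    ~-reflexive {a} refl = ⌊ ℤ.divides 0ℤ (ℤ.+-inverseʳ a) ⌋

    ~-refl : ∀ {a} → a ~ a
    ~-refl = ~-reflexive refl

    ~-sym : ∀ {a b} → a ~ b → b ~ a
    ~-sym {a} {b} h = combine -1ℤ h (identity a b)
      where
      identity : ∀ a b → b - a ≡ -1ℤ * (a - b)
      identity = solve-∀

    ~-trans : ∀ {a b c} → a ~ b → b ~ c → a ~ c
    ~-trans {a} {b} {c} h k = combine₂ 1ℤ h 1ℤ k (identity a b c)
      where
      identity : ∀ a b c → a - c ≡ 1ℤ * (a - b) + 1ℤ * (b - c)
      identity = solve-∀

    ~-setoid : Setoid _ _
    ~-setoid = record
      { Carrier = ℤ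
      ; _≈_ = _~_
      ; isEquivalence = record { refl = ~-refl ; sym = ~-sym ; trans = ~-trans }
      }

    module ~-Reasoning = SetoidReasoning ~-setoid

    +-cong : ∀ {a b c d} → a ~ b → c ~ d → a + c ~ b + d
    +-cong {a} {b} {c} {d} h k = combine₂ 1ℤ h 1ℤ k (identity a b c d)
      where
      identity : ∀ a b c d → (a + c) - (b + d) ≡ 1ℤ * (a - b) + 1ℤ * (c - d)
      identity = solve-∀

    *-cong : ∀ {a b c d} → a ~ b → c ~ d → a * c ~ b * d
    *-cong {a} {b} {c} {d} h k = combine₂ c h b k (identity a b c d)
      where
      identity : ∀ a b c d → a * c - b * d ≡ c * (a - b) + b * (c - d)
      identity = solve-∀

    *-congˡ : ∀ a {b c} → b ~ c → a * b ~ a * c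
    *-congˡ a = *-cong (~-refl {a})

    +-congˡ : ∀ a {b c} → b ~ c → a + b ~ a + c
    +-congˡ a = +-cong (~-refl {a})

    neg-cong : ∀ {a b} → a ~ b → - a ~ - b
    neg-cong {a} {b} h = combine -1ℤ h (identity a b)
      where
      identity : ∀ a b → - a - - b ≡ -1ℤ * (a - b)
      identity = solve-∀

    sub-cong : ∀ {a b c d} → a ~ b → c ~ d → a - c ~ b - d
    sub-cong h k = +-cong h (neg-cong k)

    ^-cong : ∀ {a b} k → a ~ b → a ^ k ~ b ^ k
    ^-cong zero    h = ~-refl
    ^-cong (suc k) h = *-cong h (^-cong k h)

    cancel-unit : ∀ {a b c} u → u * c ~ 1ℤ → u * a ~ u * b → a ~ b
    cancel-unit {a} {b} {c} u unit h = combine₂ c h (b - a) unit (identity a b c u)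
      where
      identity : ∀ a b c u → a - b ≡ c * (u * a - u * b) + (b - a) * (u * c - 1ℤ)
      identity = solve-∀

  -- Finite sums over intervals.

  ∑< : ℕ → (ℕ → ℤ) → ℤ
  ∑< zero    f = 0ℤ
  ∑< (suc b) f = ∑< b f + f b

  ∑<-+ : ∀ b f g → ∑< b (λ j → f j + g j) ≡ ∑< b f + ∑< b g
  ∑<-+ zero    f g = refl
  ∑<-+ (suc b) f g = ≡.trans (cong (_+ (f b + g b)) (∑<-+ b f g))
                             (identity (∑< b f) (∑< b g) (f b) (g b))
    where
    identity : ∀ a b c d → a + b + (c + d) ≡ a + c + (b + d)
    identity = solve-∀

  ∑<-* : ∀ b c f → ∑< b (λ j → c * f j) ≡ c * ∑< b f
  ∑<-* zero    c f = ≡.sym (ℤ.*-zeroʳ c)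
  ∑<-* (suc b) c f = ≡.trans (cong (_+ c * f b) (∑<-* b c f)) (≡.sym (ℤ.*-distribˡ-+ c _ _))

  ∑<-telescope : ∀ b (f : ℕ → ℤ) → ∑< b (λ j → f j - f (suc j)) ≡ f 0 - f b
  ∑<-telescope zero    f = ≡.sym (ℤ.+-inverseʳ (f 0))
  ∑<-telescope (suc b) f = ≡.trans (cong (_+ (f b - f (suc b))) (∑<-telescope b f))
                                   (identity (f 0) (f b) (f (suc b)))
    where
    identity : ∀ a b c → a - b + (b - c) ≡ a - c
    identity = solve-∀

  -- If n > b, this is minus the sum over b ≤ j < n.
  ∑[_,_] : ℕ → ℕ → (ℕ → ℤ) → ℤ
  ∑[ n , b ] f = ∑< b f - ∑< n f

  ∑[]-first : ∀ n b f → ∑[ n , b ] f ≡ f n + ∑[ suc n , b ] f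
  ∑[]-first n b f = identity (∑< b f) (∑< n f) (f n)
    where
    identity : ∀ a b c → a - b ≡ c + (a - (b + c))
    identity = solve-∀

  ∑[]-telescope : ∀ n b (f : ℕ → ℤ) → ∑[ n , b ] (λ j → f j - f (suc j)) ≡ f n - f b
  ∑[]-telescope n b f = ≡.trans (cong₂ _-_ (∑<-telescope b f) (∑<-telescope n f))
                                (identity (f 0) (f b) (f n))
    where
    identity : ∀ a b c → a - b - (a - c) ≡ c - b
    identity = solve-∀

  ∑[]-+ : ∀ n b f g → ∑[ n , b ] (λ j → f j + g j) ≡ ∑[ n , b ] f + ∑[ n , b ] g
  ∑[]-+ n b f g = ≡.trans (cong₂ _-_ (∑<-+ b f g) (∑<-+ n f g))
                          (identity (∑< b f) (∑< b g) (∑< n f) (∑< n g))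
    where
    identity : ∀ a b c d → a + b - (c + d) ≡ a - c + (b - d)
    identity = solve-∀

  ∑[]-* : ∀ n b c f → ∑[ n , b ] (λ j → c * f j) ≡ c * ∑[ n , b ] f
  ∑[]-* n b c f = ≡.trans (cong₂ _-_ (∑<-* b c f) (∑<-* n c f)) (≡.sym (distrib c _ _))
    where
    distrib : ∀ a b c → a * (b - c) ≡ a * b - a * c
    distrib = solve-∀

  -- Summation operators and linear functionals modulo p.

  -- N = p - 1, and functions are used on {0, …, N} only.
  module Operators (N : ℕ) (ι : ℕ → ℤ) where

    open Congruence (suc N)

    ∑<-cong : ∀ {f g} b → (∀ j → j < b → f j ~ g j) → ∑< b f ~ ∑< b g
    ∑<-cong zero    h = ~-refl
    ∑<-cong (suc b) h = +-cong (∑<-cong b λ j j<b → h j (ℕ.m<n⇒m<1+n j<b)) (h b ℕ.≤-refl)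

    ∑[]-cong : ∀ {f g n} → n ≤ N → (∀ j → j < N → f j ~ g j) → ∑[ n , N ] f ~ ∑[ n , N ] g
    ∑[]-cong {n = n} n≤N h =
      sub-cong (∑<-cong N h) (∑<-cong n λ j j<n → h j (ℕ.<-≤-trans j<n n≤N))

    -- With ι j = 1/(j+1), these are the sums of φ(n′)/n′ᵏ over n < n′ ≤ N and of
    -- φ(l′-1)/l′ᵏ over 0 < l′ ≤ l.
    T U : ℕ → (ℕ → ℤ) → ℕ → ℤ
    T k φ n = ∑[ n , N ] (λ j → ι j ^ k * φ (suc j))
    U k φ l = ∑< l (λ j → ι j ^ k * φ j)

    -- Meant for iterated sums over one word, seen as functionals of their innermost summand. By
    -- linearity they commute with the finite sums `T` and `U`, which lets a sum produced by the
    -- connector be moved out of the sums over n and m.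
    record Linear (L : (ℕ → ℤ) → ℤ) : Set where
      field
        L-cong : ∀ {φ ψ} → (∀ n → n ≤ N → φ n ~ ψ n) → L φ ~ L ψ
        L-+    : ∀ φ ψ → L (λ n → φ n + ψ n) ~ L φ + L ψ
        L-*    : ∀ c φ → L (λ n → c * φ n) ~ c * L φ

      open ~-Reasoning

      L-0 : L (λ _ → 0ℤ) ~ 0ℤ
      L-0 = ~-trans (L-* 0ℤ (λ _ → 0ℤ)) (~-reflexive (ℤ.*-zeroˡ (L (λ _ → 0ℤ))))

      L-- : ∀ (φ ψ : ℕ → ℤ) → L (λ n → φ n - ψ n) ~ L φ - L ψ
      L-- φ ψ = begin
        L (λ n → φ n - ψ n)
          ≈⟨ L-+ φ _ ⟩
        L φ + L (λ n → - ψ n)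
          ≈⟨ +-congˡ (L φ) (L-cong λ n _ → ~-reflexive (≡.sym (ℤ.-1*i≡-i (ψ n)))) ⟩
        L φ + L (λ n → -1ℤ * ψ n)
          ≈⟨ +-congˡ (L φ) (L-* -1ℤ ψ) ⟩
        L φ + -1ℤ * L ψ
          ≡⟨ cong (λ t → L φ + t) (ℤ.-1*i≡-i (L ψ)) ⟩
        L φ - L ψ ∎

      L-∑< : ∀ b (c : ℕ → ℤ) (Φ : ℕ → ℕ → ℤ) →
             L (λ n → ∑< b (λ j → c j * Φ j n)) ~ ∑< b (λ j → c j * L (Φ j))
      L-∑< zero    c Φ = L-0
      L-∑< (suc b) c Φ = ~-trans (L-+ _ _) (+-cong (L-∑< b c Φ) (L-* (c b) (Φ b)))

      L-U : ∀ k l (Φ : ℕ → ℕ → ℤ) → L (λ n → U k (λ l′ → Φ l′ n) l) ~ U k (λ l′ → L (Φ l′)) l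
      L-U k l Φ = L-∑< l (λ j → ι j ^ k) Φ

      L-T : ∀ k m (Φ : ℕ → ℕ → ℤ) → L (λ n → T k (λ m′ → Φ m′ n) m) ~ T k (λ m′ → L (Φ m′)) m
      L-T k m Φ = ~-trans (L-- _ _) (sub-cong (L-∑< N (λ j → ι j ^ k) (λ j → Φ (suc j)))
                                              (L-∑< m (λ j → ι j ^ k) (λ j → Φ (suc j))))

    open Linear public

    evaluation-linear : ∀ {n} → n ≤ N → Linear (λ φ → φ n)
    evaluation-linear {n} n≤N = record
      { L-cong = λ h → h n n≤N ; L-+ = λ _ _ → ~-refl ; L-* = λ _ _ → ~-refl }

    ∘-linear : ∀ {L} {G : (ℕ → ℤ) → ℕ → ℤ} → Linear L → (∀ n → n ≤ N → Linear (λ φ → G φ n)) →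
               Linear (λ φ → L (G φ))
    ∘-linear lin G-lin = record
      { L-cong = λ h → L-cong lin λ n n≤N → L-cong (G-lin n n≤N) h
      ; L-+ = λ φ ψ → ~-trans (L-cong lin λ n n≤N → L-+ (G-lin n n≤N) φ ψ) (L-+ lin _ _)
      ; L-* = λ c φ → ~-trans (L-cong lin λ n n≤N → L-* (G-lin n n≤N) c φ) (L-* lin c _)
      }

    private
      weigh-+ : ∀ c a b → c * (a + b) ≡ c * a + c * b
      weigh-+ = solve-∀

      weigh-* : ∀ c d a → c * (d * a) ≡ d * (c * a)
      weigh-* = solve-∀

    U-linear : ∀ k {l} → l ≤ N → Linear (λ φ → U k φ l)
    U-linear k {l} l≤N = record
      { L-cong = λ h → ∑<-cong l λ j j<l → *-congˡ (ι j ^ k) (h j (ℕ.<⇒≤ (ℕ.<-≤-trans j<l l≤N)))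
      ; L-+ = λ φ ψ → ~-trans
          (∑<-cong l λ j _ → ~-reflexive (weigh-+ (ι j ^ k) (φ j) (ψ j)))
          (~-reflexive (∑<-+ l _ _))
      ; L-* = λ c φ → ~-trans
          (∑<-cong l λ j _ → ~-reflexive (weigh-* (ι j ^ k) c (φ j)))
          (~-reflexive (∑<-* l c _))
      }

    T-linear : ∀ k {n} → n ≤ N → Linear (λ φ → T k φ n)
    T-linear k {n} n≤N = record
      { L-cong = λ h → ∑[]-cong n≤N λ j j<N → *-congˡ (ι j ^ k) (h (suc j) j<N)
      ; L-+ = λ φ ψ → ~-trans
          (∑[]-cong n≤N λ j _ → ~-reflexive (weigh-+ (ι j ^ k) (φ (suc j)) (ψ (suc j))))
          (~-reflexive (∑[]-+ n N _ _))
      ; L-* = λ c φ → ~-trans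
          (∑[]-cong n≤N λ j _ → ~-reflexive (weigh-* (ι j ^ k) c (φ (suc j))))
          (~-reflexive (∑[]-* n N c _))
      }

  -- Shifted numerals, the indicator of n ≤ l, and weights of words.

  σ : ℕ → ℤ
  σ j = + suc j

  -- The indicator of n ≤ l. It is the value of the connector when its other argument is 0.
  χ : ℕ → ℕ → ℤ
  χ zero    l       = 1ℤ
  χ (suc n) zero    = 0ℤ
  χ (suc n) (suc l) = χ n l

  χ-≤ : ∀ {n l} → n ≤ l → χ n l ≡ 1ℤ
  χ-≤ z≤n       = refl
  χ-≤ (s≤s n≤l) = χ-≤ n≤l

  χ-> : ∀ {n l} → l < n → χ n l ≡ 0ℤ
  χ-> {suc n} {zero}  _         = refl
  χ-> {suc n} {suc l} (s≤s l<n) = χ-> l<n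

  x0≡y0 : ∀ x y → x * 0ℤ ≡ y * 0ℤ
  x0≡y0 x y = ≡.trans (ℤ.*-zeroʳ x) (≡.sym (ℤ.*-zeroʳ y))

  -- The difference of the two indicators is nonzero only for n = l.
  χ-diagonal : ∀ (f : ℕ → ℤ) n l →
               f n * (χ n l - χ (suc n) l) ≡ f l * (χ n l - χ (suc n) l)
  χ-diagonal f zero    zero    = refl
  χ-diagonal f zero    (suc l) = x0≡y0 (f 0) (f (suc l))
  χ-diagonal f (suc n) zero    = x0≡y0 (f (suc n)) (f 0)
  χ-diagonal f (suc n) (suc l) = χ-diagonal (λ j → f (suc j)) n l

  ∑[]-linear₄ : ∀ n b c₁ c₂ c₃ c₄ (f₁ f₂ f₃ f₄ : ℕ → ℤ) →
                ∑[ n , b ] (λ j → c₁ * f₁ j + c₂ * f₂ j + c₃ * f₃ j + c₄ * f₄ j)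
                  ≡ c₁ * ∑[ n , b ] f₁ + c₂ * ∑[ n , b ] f₂ + c₃ * ∑[ n , b ] f₃ + c₄ * ∑[ n , b ] f₄
  ∑[]-linear₄ n b c₁ c₂ c₃ c₄ f₁ f₂ f₃ f₄ =
    ≡.trans (∑[]-+ n b _ _) (cong₂ _+_
      (≡.trans (∑[]-+ n b _ _) (cong₂ _+_
        (≡.trans (∑[]-+ n b _ _) (cong₂ _+_ (∑[]-* n b c₁ f₁) (∑[]-* n b c₂ f₂)))
        (∑[]-* n b c₃ f₃)))
      (∑[]-* n b c₄ f₄))

  weight : Letter₂₃ → ℕ
  weight a = index (letter a)

  wt-∷ʳ : ∀ w a → wt (w ∷ʳ a) ≡ weight a ℕ.+ wt w
  wt-∷ʳ w a = begin
    sum (map weight (w ∷ʳ a))             ≡⟨ cong sum (map-++ weight w [ a ]) ⟩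
    sum (map weight w ++ [ weight a ])    ≡⟨ sum-++ (map weight w) [ weight a ] ⟩
    wt w ℕ.+ (weight a ℕ.+ 0)             ≡⟨ cong (wt w ℕ.+_) (ℕ.+-identityʳ (weight a)) ⟩
    wt w ℕ.+ weight a                     ≡⟨ ℕ.+-comm (wt w) (weight a) ⟩
    weight a ℕ.+ wt w                     ∎
    where open ≡.≡-Reasoning

  -1*^ : ∀ x k → (-1ℤ * x) ^ k ≡ -1ℤ ^ k * x ^ k
  -1*^ x zero    = refl
  -1*^ x (suc k) = ≡.trans (cong (-1ℤ * x *_) (-1*^ x k)) (identity x (-1ℤ ^ k) (x ^ k))
    where
    identity : ∀ x u v → -1ℤ * x * (u * v) ≡ -1ℤ * u * (x * v)
    identity = solve-∀

  -- The connector and its recurrences.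

  module ConnectedSums (N : ℕ) (ι : ℕ → ℤ)
                       (σ-unit : ∀ j → j < N → Congruence._~_ (suc N) (σ j * ι j) 1ℤ) where

    open Congruence (suc N)
    open Operators N ι

    -- The factor n²/l² relating the increment of the connector in l to its decrease in n, at
    -- shifted indices. Taking this relation as the definition of `C` avoids factorials.
    ratio² : ℕ → ℕ → ℤ
    ratio² n l = (σ n * ι l) * (σ n * ι l)

    -- Modulo p this is n! m! (l-n)! (l-m)! / ((n+m)! l! (l-n-m)!) if n + m ≤ l ≤ N.
    C : ℕ → ℕ → ℕ → ℤ
    C zero    m l       = χ m l
    C (suc n) m zero    = 0ℤ
    C (suc n) m (suc l) = C (suc n) m l + ratio² n l * (C n m l - C (suc n) m l)

    -- Both values of `C` on the right of the recursion satisfy the same inequality, so induction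
    -- makes them 0.
    C-support : ∀ n m l → l < n ℕ.+ m → C n m l ≡ 0ℤ
    C-support zero    m l       l<m = χ-> l<m
    C-support (suc n) m zero    _   = refl
    C-support (suc n) m (suc l) l<n+m
      rewrite C-support (suc n) m l (ℕ.<⇒≤ l<n+m) | C-support n m l (ℕ.≤-pred l<n+m)
      = ≡.trans (ℤ.+-identityˡ _) (ℤ.*-zeroʳ (ratio² n l))

    -- The difference of indicators lives on m = l, where the factor `ratio²` is 1 modulo p. This
    -- starts the induction for the recurrence in m.
    χ-recurrence : ∀ m l → l < N →
                   χ (suc m) (suc l) ~ χ (suc m) l + ratio² m l * (χ m l - χ (suc m) l)
    χ-recurrence m l l<N =
      ~-trans (combine (- ((σ l * ι l + 1ℤ) * (χ m l - χ (suc m) l))) (σ-unit l l<N)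
                 (identity (χ m l) (χ (suc m) l) (σ l * ι l)))
              (~-reflexive (cong (λ t → χ (suc m) l + t) (≡.sym (χ-diagonal (λ j → ratio² j l) m l))))
      where
      identity : ∀ x y r → x - (y + r * r * (x - y)) ≡ - ((r + 1ℤ) * (x - y)) * (r - 1ℤ)
      identity = solve-∀

    mutual

      -- The definition of `C` lowers n; this is its mirror image in m. The two recurrences differ
      -- by `C-balance` divided by (l+1)², and `C-balance` at l + 1 follows from itself at l and
      -- from the present recurrence at the smaller n.
      C-recurrenceʳ : ∀ n m l → l < N →
                      C n (suc m) (suc l) ~ C n (suc m) l + ratio² m l * (C n m l - C n (suc m) l)
      C-recurrenceʳ zero    m l l<N = χ-recurrence m l l<N
      C-recurrenceʳ (suc n) m l l<N =
        combine (ι l * ι l) (C-balance n m l (ℕ.<⇒≤ l<N))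
          (identity (C (suc n) (suc m) l) (C n (suc m) l) (C (suc n) m l) (σ n) (σ m) (ι l))
        where
        identity : ∀ a b d s t i →
          (a + (s * i) * (s * i) * (b - a)) - (a + (t * i) * (t * i) * (d - a))
            ≡ (i * i) * (s * s * (b - a) - t * t * (d - a))
        identity = solve-∀

      -- Both sides are (l+1)² (C (n+1) (m+1) (l+1) - C (n+1) (m+1) l).
      C-balance : ∀ n m l → l ≤ N →
                  σ n * σ n * (C n (suc m) l - C (suc n) (suc m) l)
                    ~ σ m * σ m * (C (suc n) m l - C (suc n) (suc m) l)
      C-balance zero    m zero    _   = ~-reflexive (x0≡y0 (σ 0 * σ 0) (σ m * σ m))
      C-balance (suc n) m zero    _   = ~-reflexive (x0≡y0 (σ (suc n) * σ (suc n)) (σ m * σ m))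
      C-balance n       m (suc l) l<N =
        ~-trans (*-congˡ (σ n * σ n) (sub-cong (C-recurrenceʳ n m l l<N) ~-refl))
          (combine (1ℤ - ratio² n l) (C-balance n m l (ℕ.<⇒≤ l<N))
            (identity (C (suc n) (suc m) l) (C n (suc m) l) (C (suc n) m l) (C n m l) (σ n) (σ m) (ι l)))
        where
        identity : ∀ a b d e s t i →
          s * s * (b + (t * i) * (t * i) * (e - b) - (a + (s * i) * (s * i) * (b - a)))
            - t * t * (d + (s * i) * (s * i) * (e - d) - (a + (s * i) * (s * i) * (b - a)))
            ≡ (1ℤ - (s * i) * (s * i)) * (s * s * (b - a) - t * t * (d - a))
        identity = solve-∀

    -- Both sides obey the recursion defining `C`, the indicator by `χ-recurrence`. It handles an
    -- empty second word.
    C-axis : ∀ n l → l ≤ N → C n 0 l ~ χ n l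
    C-axis zero    l       _   = ~-refl
    C-axis (suc n) zero    _   = ~-refl
    C-axis (suc n) (suc l) l<N = begin
      C (suc n) 0 l + ratio² n l * (C n 0 l - C (suc n) 0 l)
        ≈⟨ +-cong ihˢ (*-congˡ (ratio² n l) (sub-cong (C-axis n l (ℕ.<⇒≤ l<N)) ihˢ)) ⟩
      χ (suc n) l + ratio² n l * (χ n l - χ (suc n) l)
        ≈⟨ χ-recurrence n l l<N ⟨
      χ n l ∎
      where
      open ~-Reasoning
      ihˢ = C-axis (suc n) l (ℕ.<⇒≤ l<N)

    mutual

      -- The quotient of neighbouring values in the factorial formula, C(n+1,m;l) / C(n,m;l) =
      -- (n+1)(l-n-m) / ((l-n)(n+m+1)), with denominators cleared. It is proved together with the
      -- quotient in the direction of l, since the recursion for `C` mixes both directions.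
      C-ratioˡ : ∀ n m l → l ≤ N →
                 σ n * (+ l - + n - + m) * C n m l ~ (+ l - + n) * (σ n + + m) * C (suc n) m l
      C-ratioˡ zero    zero    zero    _ = ~-refl
      C-ratioˡ zero    (suc m) zero    _ =
        ~-reflexive (x0≡y0 (σ 0 * (0ℤ - 0ℤ - σ m)) ((0ℤ - 0ℤ) * (σ 0 + σ m)))
      C-ratioˡ (suc n) m       zero    _ =
        ~-reflexive (x0≡y0 (σ (suc n) * (0ℤ - σ n - + m)) ((0ℤ - σ n) * (σ (suc n) + + m)))
      C-ratioˡ n       m       (suc l) l<N =
        combine₃ (σ n * ι l) (C-ratioʳ n m l l<N)
                 ((σ l - + n) * (ι l * ι l) * (σ l + σ n)) (C-ratioˡ n m l (ℕ.<⇒≤ l<N))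
                 ((σ l - + n) * (σ n + + m) * C (suc n) m l * (σ l * ι l + 1ℤ)
                   - σ n * (σ l - + n - + m) * C n m (suc l)
                   - (σ l - + n) * (σ n * ι l) * C n m l * (σ l - + m)) (σ-unit l l<N)
                 (identity (+ l) (+ n) (+ m) (ι l) (C n m l) (C (suc n) m l) (C n m (suc l)))
        where
        identity : ∀ x y z i e d e′ →
          (1ℤ + y) * (1ℤ + x - y - z) * e′
            - (1ℤ + x - y) * (1ℤ + y + z) * (d + ((1ℤ + y) * i) * ((1ℤ + y) * i) * (e - d))
            ≡ (1ℤ + y) * i * ((1ℤ + x) * (1ℤ + x - y - z) * e′ - (1ℤ + x - y) * (1ℤ + x - z) * e)
              + (1ℤ + x - y) * (i * i) * (1ℤ + x + (1ℤ + y))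
                  * ((1ℤ + y) * (x - y - z) * e - (x - y) * (1ℤ + y + z) * d)
              + ((1ℤ + x - y) * (1ℤ + y + z) * d * ((1ℤ + x) * i + 1ℤ)
                   - (1ℤ + y) * (1ℤ + x - y - z) * e′
                   - (1ℤ + x - y) * ((1ℤ + y) * i) * e * (1ℤ + x - z)) * ((1ℤ + x) * i - 1ℤ)
        identity = solve-∀

      -- With x = l + 1, the identity (x-n)(x-m) = x(x-n-m) + nm makes this the relation between the
      -- increment in l and nm C(n,m;l).
      C-ratioʳ : ∀ n m l → l < N →
                 σ l * (σ l - + n - + m) * C n m (suc l) ~ (σ l - + n) * (σ l - + m) * C n m l
      C-ratioʳ zero    zero    l _ = ~-reflexive (identity (σ l))
        where
        identity : ∀ x → x * (x - 0ℤ - 0ℤ) * 1ℤ ≡ (x - 0ℤ) * (x - 0ℤ) * 1ℤ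
        identity = solve-∀
      C-ratioʳ zero    (suc m) l _ =
        combine (- σ l) (~-reflexive (χ-diagonal σ m l))
          (identity (σ l) (σ m) (χ m l) (χ (suc m) l))
        where
        identity : ∀ x z a b → x * (x - 0ℤ - z) * a - (x - 0ℤ) * (x - z) * b
                                 ≡ (- x) * (z * (a - b) - x * (a - b))
        identity = solve-∀
      C-ratioʳ (suc n) m       l l<N =
        combine₂ (σ l * (ι l * ι l) * σ n) (C-ratioˡ n m l (ℕ.<⇒≤ l<N))
                 (C (suc n) m l * σ n * + m * (σ l * ι l + 1ℤ)) (σ-unit l l<N)
                 (identity (+ l) (+ n) (+ m) (ι l) (C n m l) (C (suc n) m l))
        where
        identity : ∀ x y z i b e →
          (1ℤ + x) * (1ℤ + x - (1ℤ + y) - z) * (e + ((1ℤ + y) * i) * ((1ℤ + y) * i) * (b - e))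
            - (1ℤ + x - (1ℤ + y)) * (1ℤ + x - z) * e
            ≡ (1ℤ + x) * (i * i) * (1ℤ + y) * ((1ℤ + y) * (x - y - z) * b - (x - y) * (1ℤ + y + z) * e)
              + e * (1ℤ + y) * z * ((1ℤ + x) * i + 1ℤ) * ((1ℤ + x) * i - 1ℤ)
        identity = solve-∀

    p~0 : σ N ~ 0ℤ
    p~0 = ⌊ ℤ.divides 1ℤ (identity (σ N)) ⌋
      where
      identity : ∀ x → x - 0ℤ ≡ 1ℤ * x
      identity = solve-∀

    -- As N is -1 modulo p, both coefficients in `C-ratioˡ` at l = N become -(n+1)(n+m+1), a product
    -- of units when n + m < N.
    C-final-step : ∀ n m → suc n ℕ.+ m ≤ N → C (suc n) m N ~ C n m N
    C-final-step n m n+m<N =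
      cancel-unit (σ n) (σ-unit n (ℕ.≤-trans (s≤s (ℕ.m≤m+n n m)) n+m<N))
        (cancel-unit (σ (n ℕ.+ m)) (σ-unit (n ℕ.+ m) n+m<N)
          (combine₂ 1ℤ (C-ratioˡ n m N ℕ.≤-refl)
             ((1ℤ + + n + + m) * C (suc n) m N - (1ℤ + + n) * C n m N) p~0
             (identity (+ N) (+ n) (+ m) (C n m N) (C (suc n) m N))))
      where
      identity : ∀ x y z e d →
        (1ℤ + (y + z)) * ((1ℤ + y) * d) - (1ℤ + (y + z)) * ((1ℤ + y) * e)
          ≡ 1ℤ * ((1ℤ + y) * (x - y - z) * e - (x - y) * (1ℤ + y + z) * d)
            + ((1ℤ + y + z) * d - (1ℤ + y) * e) * (1ℤ + x - 0ℤ)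
      identity = solve-∀

    C-final-1 : ∀ n m → n ℕ.+ m ≤ N → C n m N ~ 1ℤ
    C-final-1 zero    m m≤N   = ~-reflexive (χ-≤ m≤N)
    C-final-1 (suc n) m n+m<N = ~-trans (C-final-step n m n+m<N) (C-final-1 n m (ℕ.<⇒≤ n+m<N))

    -- The connector is 1 for n + m ≤ N and vanishes beyond. Written as an indicator of m ≤ N - n,
    -- it leaves a truncated sum over m, ready for the reflection m ↦ p - m.
    C-final : ∀ n m → n ≤ N → C n m N ~ χ m (N ∸ n)
    C-final n m n≤N with ℕ.≤-<-connex m (N ∸ n)
    ... | inj₁ m≤N∸n = ~-trans (C-final-1 n m n+m≤N) (~-reflexive (≡.sym (χ-≤ m≤N∸n)))
      where
      n+m≤N : n ℕ.+ m ≤ N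
      n+m≤N = subst (n ℕ.+ m ≤_) (ℕ.m+[n∸m]≡n n≤N) (ℕ.+-monoʳ-≤ n m≤N∸n)
    ... | inj₂ N∸n<m = ~-reflexive (≡.trans (C-support n m N N<n+m) (≡.sym (χ-> N∸n<m)))
      where
      N<n+m : N < n ℕ.+ m
      N<n+m = subst (_< n ℕ.+ m) (ℕ.m+[n∸m]≡n n≤N) (ℕ.+-monoʳ-< n N∸n<m)

    -- Telescoping: sums over n and m become sums over l.

    T-zero : ∀ k φ {n} → n ≤ N → (∀ j → j < N → φ (suc j) ~ 0ℤ) → T k φ n ~ 0ℤ
    T-zero k φ {n} n≤N h = begin
      T k φ n                     ≈⟨ ∑[]-cong n≤N (λ j j<N → *-congˡ (ι j ^ k) (h j j<N)) ⟩
      T k (λ _ → 0ℤ) n            ≈⟨ L-0 (T-linear k n≤N) ⟩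
      0ℤ                          ∎
      where open ~-Reasoning

    -- Induction on l. By `step`, raising l by one changes the left side by a telescoping sum in n;
    -- its upper end vanishes by `last`, and its lower end is the new summand of `U`.
    exchange : ∀ k (Φ : ℕ → ℕ → ℤ) →
               (∀ n → n < N → Φ (suc n) 0 ~ 0ℤ) →
               (∀ n l → n < N → l < N →
                  ι n ^ k * (Φ (suc n) (suc l) - Φ (suc n) l) ~ ι l ^ k * (Φ n l - Φ (suc n) l)) →
               (∀ l → l < N → Φ N l ~ 0ℤ) →
               ∀ {n} l → n ≤ N → l ≤ N → T k (λ n′ → Φ n′ l) n ~ U k (Φ n) l
    exchange k Φ first step last zero n≤N _ = T-zero k (λ n′ → Φ n′ 0) n≤N first
    exchange k Φ first step last {n} (suc l) n≤N l<N = begin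
      T k (λ n′ → Φ n′ (suc l)) n
        ≈⟨ ∑[]-cong n≤N (λ j j<N → combine 1ℤ (step j l j<N l<N)
             (identity (ι j ^ k) (ι l ^ k) (Φ (suc j) (suc l)) (Φ (suc j) l) (Φ j l))) ⟩
      ∑[ n , N ] (λ j → ι j ^ k * Φ (suc j) l + ι l ^ k * (Φ j l - Φ (suc j) l))
        ≡⟨ ∑[]-+ n N _ _ ⟩
      T k (λ n′ → Φ n′ l) n + ∑[ n , N ] (λ j → ι l ^ k * (Φ j l - Φ (suc j) l))
        ≡⟨ cong (λ t → T k (λ n′ → Φ n′ l) n + t)
             (≡.trans (∑[]-* n N (ι l ^ k) _)
                      (cong (ι l ^ k *_) (∑[]-telescope n N (λ j → Φ j l)))) ⟩
      T k (λ n′ → Φ n′ l) n + ι l ^ k * (Φ n l - Φ N l)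
        ≈⟨ +-cong (exchange k Φ first step last l n≤N (ℕ.<⇒≤ l<N)) (*-congˡ (ι l ^ k)
             (~-trans (+-congˡ (Φ n l) (neg-cong (last l l<N)))
                      (~-reflexive (ℤ.+-identityʳ (Φ n l))))) ⟩
      U k (Φ n) (suc l) ∎
      where
      open ~-Reasoning
      identity : ∀ a i x y w → a * x - (a * y + i * (w - y)) ≡ 1ℤ * (a * (x - y) - i * (w - y))
      identity = solve-∀

    χ-transport : ∀ k {n} l → n ≤ N → l ≤ N → T k (λ n′ → χ n′ l) n ~ U k (χ n) l
    χ-transport k = exchange k χ (λ _ _ → ~-refl)
      (λ n l _ _ → ~-reflexive (χ-diagonal (λ j → ι j ^ k) n l))
      (λ l l<N → ~-reflexive (χ-> l<N))

    private
      -- Multiplication by 1/(n+1)² cancels the numerator of `ratio²`, which brings the recurrence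
      -- into the form that `exchange` expects.
      square-step : ∀ n l {x} a b → n < N → x ~ a + ratio² n l * (b - a) →
                    ι n ^ 2 * (x - a) ~ ι l ^ 2 * (b - a)
      square-step n l {x} a b n<N h =
        combine₂ (ι n ^ 2) h (ι l ^ 2 * (b - a) * (σ n * ι n + 1ℤ)) (σ-unit n n<N)
          (identity (σ n) (ι n) (ι l) x a b)
        where
        identity : ∀ s a i x y w →
          a * (a * 1ℤ) * (x - y) - i * (i * 1ℤ) * (w - y)
            ≡ a * (a * 1ℤ) * (x - (y + (s * i) * (s * i) * (w - y)))
              + i * (i * 1ℤ) * (w - y) * (s * a + 1ℤ) * (s * a - 1ℤ)
        identity = solve-∀

    C-transportˡ : ∀ {n} m l → n ≤ N → l ≤ N → T 2 (λ n′ → C n′ m l) n ~ U 2 (C n m) l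
    C-transportˡ m = exchange 2 (λ n l → C n m l) (λ _ _ → ~-refl)
      (λ n l n<N _ → square-step n l (C (suc n) m l) (C n m l) n<N ~-refl)
      (λ l l<N → ~-reflexive (C-support N m l (ℕ.<-≤-trans l<N (ℕ.m≤m+n N m))))

    C-transportʳ : ∀ n {m} l → m ≤ N → l ≤ N → T 2 (λ m′ → C n m′ l) m ~ U 2 (C n m) l
    C-transportʳ n = exchange 2 (C n)
      (λ m _ → ~-reflexive (C-support n (suc m) 0 (ℕ.<-≤-trans (s≤s z≤n) (ℕ.m≤n+m (suc m) n))))
      (λ m l m<N l<N → square-step m l (C n (suc m) l) (C n m l) m<N (C-recurrenceʳ n m l l<N))
      (λ l l<N → ~-reflexive (C-support n N l (ℕ.<-≤-trans l<N (ℕ.m≤n+m N n))))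

    private
      -- With s = n + 1, t = m + 1, x = l + 1, the increment X - A satisfies x(x-s-t)(X-A) = stA.
      -- Division by x²s³t³ splits it into three parts, two of which the recurrences in n and in m
      -- turn into B - A and D - A. The terms are grouped so that the sum over m either has the form
      -- of `T` or telescopes.
      cube-step : ∀ n m l → n < N → m < N → l < N →
                  ι n ^ 3 * (ι m ^ 3 * C (suc n) (suc m) (suc l)) ~
                    (ι n ^ 3 - ι l ^ 3) * (ι m ^ 3 * C (suc n) (suc m) l)
                    + ι l ^ 3 * (ι m ^ 3 * C n (suc m) l)
                    + (ι l ^ 3 * ι n ^ 3) * (C (suc n) m l - C (suc n) (suc m) l)
                    + (ι l ^ 2 * ι n ^ 2) * (ι m ^ 2 * C (suc n) (suc m) l)
      cube-step n m l n<N m<N l<N =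
        combine₃ -1ℤ first -1ℤ second -1ℤ third
          (identity (a ^ 2) (a ^ 3) (b ^ 2) (b ^ 3) i (i ^ 2) (i ^ 3) A B D X)
        where
        a = ι n
        b = ι m
        i = ι l
        A = C (suc n) (suc m) l
        B = C n (suc m) l
        D = C (suc n) m l
        X = C (suc n) (suc m) (suc l)

        identity : ∀ a² a³ b² b³ i i² i³ A B D X →
          a³ * (b³ * X)
            - ((a³ - i³) * (b³ * A) + i³ * (b³ * B) + (i³ * a³) * (D - A) + (i² * a²) * (b² * A))
            ≡ -1ℤ * (i³ * b³ * (B - A) - i * b³ * a² * (X - A))
              + -1ℤ * (i³ * a³ * (D - A) - i * a³ * b² * (X - A))
              + -1ℤ * (i² * a² * b² * A
                  - (a³ * b³ * (X - A) - i * b³ * a² * (X - A) - i * a³ * b² * (X - A)))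
        identity = solve-∀

        first : i ^ 3 * b ^ 3 * (B - A) ~ i * b ^ 3 * a ^ 2 * (X - A)
        first = combine (- (i ^ 3 * b ^ 3 * (B - A) * (σ n * a + 1ℤ))) (σ-unit n n<N)
                  (identity₁ (σ n) a (b ^ 3) i A B)
          where
          identity₁ : ∀ s a b³ i A B →
            i * (i * (i * 1ℤ)) * b³ * (B - A)
              - i * b³ * (a * (a * 1ℤ)) * (A + (s * i) * (s * i) * (B - A) - A)
              ≡ (- (i * (i * (i * 1ℤ)) * b³ * (B - A) * (s * a + 1ℤ))) * (s * a - 1ℤ)
          identity₁ = solve-∀

        second : i ^ 3 * a ^ 3 * (D - A) ~ i * a ^ 3 * b ^ 2 * (X - A)
        -- The value X unfolds through the recurrence in n, and `C-balance` trades B - A for D - A.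
        second = combine₂ (- (i ^ 3 * a ^ 3 * b ^ 2)) (C-balance n m l (ℕ.<⇒≤ l<N))
                   (- (i ^ 3 * a ^ 3 * (D - A) * (σ m * b + 1ℤ))) (σ-unit m m<N)
                   (identity₂ (σ n) (σ m) (a ^ 3) b i A B D)
          where
          identity₂ : ∀ s t a³ b i A B D →
            i * (i * (i * 1ℤ)) * a³ * (D - A)
              - i * a³ * (b * (b * 1ℤ)) * (A + (s * i) * (s * i) * (B - A) - A)
              ≡ (- (i * (i * (i * 1ℤ)) * a³ * (b * (b * 1ℤ)))) * (s * s * (B - A) - t * t * (D - A))
                + (- (i * (i * (i * 1ℤ)) * a³ * (D - A) * (t * b + 1ℤ))) * (t * b - 1ℤ)
          identity₂ = solve-∀

        third : i ^ 2 * a ^ 2 * b ^ 2 * A ~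
                  a ^ 3 * b ^ 3 * (X - A) - i * b ^ 3 * a ^ 2 * (X - A) - i * a ^ 3 * b ^ 2 * (X - A)
        third = begin
          -- The numerators s and t are inserted to reach `C-ratioʳ`; afterwards (x-s-t)/x is
          -- expanded as 1 - s/x - t/x.
          i ^ 2 * a ^ 2 * b ^ 2 * A
            ≈⟨ combine₂ (- (i ^ 2 * a ^ 2 * b ^ 2 * A * (σ m * b))) (σ-unit n n<N)
                        (- (i ^ 2 * a ^ 2 * b ^ 2 * A)) (σ-unit m m<N)
                        (identity₃ (σ n) (σ m) a (a ^ 2) b (b ^ 2) (i ^ 2) A) ⟩
          i ^ 2 * a ^ 3 * b ^ 3 * (σ n * σ m * A)
            ≈⟨ combine (- (i ^ 2 * a ^ 3 * b ^ 3)) (C-ratioʳ (suc n) (suc m) l l<N)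
                       (identity₄ (σ n) (σ m) (σ l) (i ^ 2 * a ^ 3 * b ^ 3) A X) ⟩
          i ^ 2 * a ^ 3 * b ^ 3 * (σ l * (σ l - σ n - σ m) * (X - A))
            ≈⟨ combine₃ (a ^ 3 * b ^ 3 * (X - A) * (σ l * i + 1ℤ - i * σ n - i * σ m)) (σ-unit l l<N)
                        (- (i * b ^ 3 * a ^ 2 * (X - A))) (σ-unit n n<N)
                        (- (i * a ^ 3 * b ^ 2 * (X - A))) (σ-unit m m<N)
                        (identity₅ (σ n) (σ m) (σ l) a (a ^ 2) b (b ^ 2) i (X - A)) ⟩
          a ^ 3 * b ^ 3 * (X - A) - i * b ^ 3 * a ^ 2 * (X - A) - i * a ^ 3 * b ^ 2 * (X - A) ∎
          where
          open ~-Reasoning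
          identity₃ : ∀ s t a a² b b² i² A →
            i² * a² * b² * A - i² * (a * a²) * (b * b²) * (s * t * A)
              ≡ (- (i² * a² * b² * A * (t * b))) * (s * a - 1ℤ)
                + (- (i² * a² * b² * A)) * (t * b - 1ℤ)
          identity₃ = solve-∀
          identity₄ : ∀ s t x c A X →
            c * (s * t * A) - c * (x * (x - s - t) * (X - A))
              ≡ (- c) * (x * (x - s - t) * X - (x - s) * (x - t) * A)
          identity₄ = solve-∀
          identity₅ : ∀ s t x a a² b b² i Y →
            i * (i * 1ℤ) * (a * a²) * (b * b²) * (x * (x - s - t) * Y)
              - (a * a² * (b * b²) * Y - i * (b * b²) * a² * Y - i * (a * a²) * b² * Y)
              ≡ (a * a² * (b * b²) * Y * (x * i + 1ℤ - i * s - i * t)) * (x * i - 1ℤ)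
                + (- (i * (b * b²) * a² * Y)) * (s * a - 1ℤ)
                + (- (i * (a * a²) * b² * Y)) * (t * b - 1ℤ)
          identity₅ = solve-∀

    -- The two-variable analogue of `exchange`, by induction on l: `cube-step` is summed over m and
    -- then over n. Each summation telescopes once, and the upper ends vanish because n + m exceeds
    -- l there.
    C-transport₃ : ∀ {n m} l → n ≤ N → m ≤ N → l ≤ N →
      T 3 (λ n′ → T 3 (λ m′ → C n′ m′ l) m) n ~
        U 3 (λ l′ → T 3 (λ m′ → C n m′ l′) m) l
        + U 3 (λ l′ → T 3 (λ n′ → C n′ m l′) n) l
        + U 2 (λ l′ → T 2 (λ n′ → T 2 (λ m′ → C n′ m′ l′) m) n) l
    C-transport₃ {m = m} zero n≤N m≤N _ =
      T-zero 3 (λ n′ → T 3 (λ m′ → C n′ m′ 0) m) n≤N λ j _ →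
        T-zero 3 (λ m′ → C (suc j) m′ 0) m≤N λ _ _ → ~-refl
    C-transport₃ {n} {m} (suc l) n≤N m≤N l<N = begin
      T 3 (λ n′ → T 3 (λ m′ → C n′ m′ (suc l)) m) n
        ≈⟨ ∑[]-cong n≤N row ⟩
      ∑[ n , N ] (λ j →
        1ℤ * (ι j ^ 3 * W (suc j)) + i³ * (W j - W (suc j)) + i³ * (ι j ^ 3 * C (suc j) m l)
        + i² * (ι j ^ 2 * Q (suc j)))
        ≡⟨ ∑[]-linear₄ n N 1ℤ i³ i³ i² _ _ _ _ ⟩
      1ℤ * T 3 W n + i³ * ∑[ n , N ] (λ j → W j - W (suc j)) + i³ * T 3 (λ n′ → C n′ m l) n
        + i² * T 2 Q n
        ≡⟨ cong (λ t → 1ℤ * T 3 W n + i³ * t + i³ * T 3 (λ n′ → C n′ m l) n + i² * T 2 Q n)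
             (∑[]-telescope n N W) ⟩
      1ℤ * T 3 W n + i³ * (W n - W N) + i³ * T 3 (λ n′ → C n′ m l) n + i² * T 2 Q n
        -- Apart from the vanishing `W N`, the terms beside `T 3 W n` are the last summands of the
        -- three sums over l′.
        ≈⟨ combine₂ 1ℤ (C-transport₃ l n≤N m≤N (ℕ.<⇒≤ l<N)) (- i³) W-last
             (identity i³ i² (W n) (W N) (T 3 (λ n′ → C n′ m l) n) (T 2 Q n) (T 3 W n)
                (U 3 (λ l′ → T 3 (λ m′ → C n m′ l′) m) l)
                (U 3 (λ l′ → T 3 (λ n′ → C n′ m l′) n) l)
                (U 2 (λ l′ → T 2 (λ n′ → T 2 (λ m′ → C n′ m′ l′) m) n) l)) ⟩
      U 3 (λ l′ → T 3 (λ m′ → C n m′ l′) m) (suc l)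
        + U 3 (λ l′ → T 3 (λ n′ → C n′ m l′) n) (suc l)
        + U 2 (λ l′ → T 2 (λ n′ → T 2 (λ m′ → C n′ m′ l′) m) n) (suc l) ∎
      where
      open ~-Reasoning

      i² = ι l ^ 2
      i³ = ι l ^ 3

      W Q : ℕ → ℤ
      W n′ = T 3 (λ m′ → C n′ m′ l) m
      Q n′ = T 2 (λ m′ → C n′ m′ l) m

      W-last : W N ~ 0ℤ
      W-last = T-zero 3 (λ m′ → C N m′ l) m≤N λ k _ →
        ~-reflexive (C-support N (suc k) l (ℕ.<-≤-trans l<N (ℕ.m≤m+n N (suc k))))

      identity : ∀ c d w w′ v q t u₁ u₂ u₃ →
        1ℤ * t + c * (w - w′) + c * v + d * q - (u₁ + c * w + (u₂ + c * v) + (u₃ + d * q))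
          ≡ 1ℤ * (t - (u₁ + u₂ + u₃)) + (- c) * (w′ - 0ℤ)
      identity = solve-∀

      row : ∀ j → j < N → ι j ^ 3 * T 3 (λ m′ → C (suc j) m′ (suc l)) m ~
              1ℤ * (ι j ^ 3 * W (suc j)) + i³ * (W j - W (suc j)) + i³ * (ι j ^ 3 * C (suc j) m l)
              + i² * (ι j ^ 2 * Q (suc j))
      row j j<N = begin
        a³ * T 3 (λ m′ → C (suc j) m′ (suc l)) m
          ≡⟨ ∑[]-* m N a³ _ ⟨
        ∑[ m , N ] (λ k → a³ * (ι k ^ 3 * C (suc j) (suc k) (suc l)))
          ≈⟨ ∑[]-cong m≤N (λ k k<N → cube-step j k l j<N k<N l<N) ⟩
        ∑[ m , N ] (λ k →
          (a³ - i³) * (ι k ^ 3 * C (suc j) (suc k) l) + i³ * (ι k ^ 3 * C j (suc k) l)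
          + (i³ * a³) * (C (suc j) k l - C (suc j) (suc k) l)
          + (i² * a²) * (ι k ^ 2 * C (suc j) (suc k) l))
          ≡⟨ ∑[]-linear₄ m N (a³ - i³) i³ (i³ * a³) (i² * a²) _ _ _ _ ⟩
        (a³ - i³) * W (suc j) + i³ * W j
          + (i³ * a³) * ∑[ m , N ] (λ k → C (suc j) k l - C (suc j) (suc k) l)
          + (i² * a²) * Q (suc j)
          ≡⟨ cong (λ t → (a³ - i³) * W (suc j) + i³ * W j + (i³ * a³) * t + (i² * a²) * Q (suc j))
               (∑[]-telescope m N (λ k → C (suc j) k l)) ⟩
        (a³ - i³) * W (suc j) + i³ * W j + (i³ * a³) * (C (suc j) m l - C (suc j) N l)
          + (i² * a²) * Q (suc j)
          ≈⟨ combine (- (i³ * a³)) last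
               (rearrange a³ a² i³ i² (W (suc j)) (W j) (C (suc j) m l) (C (suc j) N l) (Q (suc j))) ⟩
        1ℤ * (a³ * W (suc j)) + i³ * (W j - W (suc j)) + i³ * (a³ * C (suc j) m l)
          + i² * (a² * Q (suc j)) ∎
        where
        a² = ι j ^ 2
        a³ = ι j ^ 3

        last : C (suc j) N l ~ 0ℤ
        last = ~-reflexive (C-support (suc j) N l (ℕ.<-≤-trans l<N (ℕ.m≤n+m N (suc j))))

        rearrange : ∀ a a′ c d w⁺ w x x′ q →
          (a - c) * w⁺ + c * w + (c * a) * (x - x′) + (d * a′) * q
            - (1ℤ * (a * w⁺) + c * (w - w⁺) + c * (a * x) + d * (a′ * q))
            ≡ (- (c * a)) * (x′ - 0ℤ)
        rearrange = solve-∀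

    -- Iterated sums over n < n₁ < ⋯ < nᵣ ≤ N attached to words.

    J : Word Letter₂₃ → (ℕ → ℤ) → ℕ → ℤ
    J w φ = foldr (λ a → T (weight a)) φ w

    J-∷ʳ : ∀ w a φ n → J (w ∷ʳ a) φ n ≡ J w (T (weight a) φ) n
    J-∷ʳ w a φ n = cong (λ ψ → ψ n) (foldr-∷ʳ (λ a → T (weight a)) φ a w)

    J-linear : ∀ w {n} → n ≤ N → Linear (λ φ → J w φ n)
    J-linear []      n≤N = evaluation-linear n≤N
    J-linear (a ∷ w) n≤N = ∘-linear (T-linear (weight a) n≤N) (λ _ → J-linear w)

    J₀-linear : ∀ w → Linear (λ φ → J w φ 0)
    J₀-linear w = J-linear w z≤n

    -- The action on truncated sums of appending `u` to a word. The last letter belongs to the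
    -- largest variable, hence to the outermost sum over l.
    U* : Word Letter₂₃ → (ℕ → ℤ) → ℕ → ℤ
    U* u ψ = foldl (λ ψ a → U (weight a) ψ) ψ u

    U*-linear : ∀ u {l} → l ≤ N → Linear (λ ψ → U* u ψ l)
    U*-linear []      l≤N = evaluation-linear l≤N
    U*-linear (a ∷ u) l≤N = ∘-linear (U*-linear u l≤N) (λ _ → U-linear (weight a))

    -- The sum defining ζₚ(w), over nᵣ ≤ l instead of nᵣ < p.
    V : Word Letter₂₃ → ℕ → ℤ
    V w l = J w (λ n → χ n l) 0

    -- Under the outer sums, `χ-transport` replaces the innermost sum over n by a sum over l′, which
    -- `L-U` then moves outside.
    V-∷ʳ : ∀ w a {l} → l ≤ N → V (w ∷ʳ a) l ~ U (weight a) (V w) l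
    V-∷ʳ w a {l} l≤N = begin
      V (w ∷ʳ a) l
        ≡⟨ J-∷ʳ w a _ 0 ⟩
      J w (T (weight a) (λ n → χ n l)) 0
        ≈⟨ L-cong (J₀-linear w) (λ n n≤N → χ-transport (weight a) l n≤N l≤N) ⟩
      J w (λ n → U (weight a) (χ n) l) 0
        ≈⟨ L-U (J₀-linear w) (weight a) l (λ l′ n → χ n l′) ⟩
      U (weight a) (V w) l ∎
      where open ~-Reasoning

    V-++ : ∀ w u {l} → l ≤ N → V (w ++ u) l ~ U* u (V w) l
    V-++ w []      {l} l≤N = ~-reflexive (cong (λ v → V v l) (++-identityʳ w))
    V-++ w (a ∷ u) {l} l≤N = begin
      V (w ++ a ∷ u) l               ≡⟨ cong (λ v → V v l) (∷ʳ-++ w a u) ⟨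
      V (w ∷ʳ a ++ u) l              ≈⟨ V-++ (w ∷ʳ a) u l≤N ⟩
      U* u (V (w ∷ʳ a)) l            ≈⟨ L-cong (U*-linear u l≤N) (λ _ → V-∷ʳ w a) ⟩
      U* u (U (weight a) (V w)) l    ∎
      where open ~-Reasoning

    ⟦_⟧ : 𝓗²³ → ℕ → ℤ
    ⟦ f ⟧ l = foldr (λ (c , w) s → c * V w l + s) 0ℤ f

    ⟦⟧-monomial : ∀ w l → ⟦ monomial w ⟧ l ≡ V w l
    ⟦⟧-monomial w l = ≡.trans (ℤ.+-identityʳ _) (ℤ.*-identityˡ (V w l))

    ⟦⟧-⊞ : ∀ f g l → ⟦ f ⊞ g ⟧ l ≡ ⟦ f ⟧ l + ⟦ g ⟧ l
    ⟦⟧-⊞ []            g l = ≡.sym (ℤ.+-identityˡ _)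
    ⟦⟧-⊞ ((c , w) ∷ f) g l = ≡.trans (cong (λ t → c * V w l + t) (⟦⟧-⊞ f g l))
                                     (≡.sym (ℤ.+-assoc (c * V w l) (⟦ f ⟧ l) (⟦ g ⟧ l)))

    ⟦⟧-⊠ : ∀ f u {l} → l ≤ N → ⟦ f ⊠ monomial u ⟧ l ~ U* u ⟦ f ⟧ l
    ⟦⟧-⊠ []            u     l≤N = ~-sym (L-0 (U*-linear u l≤N))
    ⟦⟧-⊠ ((c , w) ∷ f) u {l} l≤N = begin
      c * 1ℤ * V (w ++ u) l + ⟦ f ⊠ monomial u ⟧ l
        ≡⟨ cong (λ t → t * V (w ++ u) l + ⟦ f ⊠ monomial u ⟧ l) (ℤ.*-identityʳ c) ⟩
      c * V (w ++ u) l + ⟦ f ⊠ monomial u ⟧ l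
        ≈⟨ +-cong (~-trans (*-congˡ c (V-++ w u l≤N)) (~-sym (L-* lin c (V w)))) (⟦⟧-⊠ f u l≤N) ⟩
      U* u (λ l′ → c * V w l′) l + U* u ⟦ f ⟧ l
        ≈⟨ L-+ lin (λ l′ → c * V w l′) ⟦ f ⟧ ⟨
      U* u ⟦ (c , w) ∷ f ⟧ l ∎
      where
      open ~-Reasoning
      lin = U*-linear u l≤N

    -- Connected sums of two words and the recursion of the star product.

    JJ : Word Letter₂₃ → Word Letter₂₃ → (ℕ → ℕ → ℤ) → ℤ
    JJ w w′ Ψ = J w (λ n → J w′ (Ψ n) 0) 0

    module _ (w w′ : Word Letter₂₃) where

      JJ-cong : ∀ {Ψ Θ} → (∀ n m → n ≤ N → m ≤ N → Ψ n m ~ Θ n m) → JJ w w′ Ψ ~ JJ w w′ Θ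
      JJ-cong h = L-cong (J₀-linear w) λ n n≤N → L-cong (J₀-linear w′) λ m → h n m n≤N

      JJ-+ : ∀ Ψ Θ → JJ w w′ (λ n m → Ψ n m + Θ n m) ~ JJ w w′ Ψ + JJ w w′ Θ
      JJ-+ Ψ Θ = ~-trans (L-cong (J₀-linear w) λ n _ → L-+ (J₀-linear w′) (Ψ n) (Θ n))
                         (L-+ (J₀-linear w) _ _)

      JJ-U : ∀ k l (Ψ : ℕ → ℕ → ℕ → ℤ) →
             JJ w w′ (λ n m → U k (λ l′ → Ψ l′ n m) l) ~ U k (λ l′ → JJ w w′ (Ψ l′)) l
      JJ-U k l Ψ = ~-trans (L-cong (J₀-linear w) λ n _ → L-U (J₀-linear w′) k l (λ l′ → Ψ l′ n))
                           (L-U (J₀-linear w) k l _)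

      -- The new sum over n′ stands outside the sums over m, so the order of summation is
      -- interchanged by `L-T`. For the second word the new sum is already innermost.
      JJ-∷ʳˡ : ∀ a Ψ → JJ (w ∷ʳ a) w′ Ψ ~ JJ w w′ (λ n m → T (weight a) (λ n′ → Ψ n′ m) n)
      JJ-∷ʳˡ a Ψ = ~-trans (~-reflexive (J-∷ʳ w a _ 0))
        (~-sym (L-cong (J₀-linear w) λ n _ → L-T (J₀-linear w′) (weight a) n Ψ))

      JJ-∷ʳʳ : ∀ a Ψ → JJ w (w′ ∷ʳ a) Ψ ~ JJ w w′ (λ n → T (weight a) (Ψ n))
      JJ-∷ʳʳ a Ψ = L-cong (J₀-linear w) λ n _ → ~-reflexive (J-∷ʳ w′ a (Ψ n) 0)

    F : Word Letter₂₃ → Word Letter₂₃ → ℕ → ℤ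
    F w w′ l = JJ w w′ (λ n m → C n m l)

    F-[]ʳ : ∀ w {l} → l ≤ N → F w [] l ~ V w l
    F-[]ʳ w {l} l≤N = L-cong (J₀-linear w) (λ n _ → C-axis n l l≤N)

    module _ (w w′ : Word Letter₂₃) where

      open ~-Reasoning

      F-z₂ˡ : ∀ {l} → l ≤ N → F (w ∷ʳ z₂) w′ l ~ U 2 (F w w′) l
      F-z₂ˡ {l} l≤N = begin
        F (w ∷ʳ z₂) w′ l
          ≈⟨ JJ-∷ʳˡ w w′ z₂ _ ⟩
        JJ w w′ (λ n m → T 2 (λ n′ → C n′ m l) n)
          ≈⟨ JJ-cong w w′ (λ n m n≤N _ → C-transportˡ m l n≤N l≤N) ⟩
        JJ w w′ (λ n m → U 2 (C n m) l)
          ≈⟨ JJ-U w w′ 2 l (λ l′ n m → C n m l′) ⟩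
        U 2 (F w w′) l ∎

      F-z₂ʳ : ∀ {l} → l ≤ N → F w (w′ ∷ʳ z₂) l ~ U 2 (F w w′) l
      F-z₂ʳ {l} l≤N = begin
        F w (w′ ∷ʳ z₂) l
          ≈⟨ JJ-∷ʳʳ w w′ z₂ _ ⟩
        JJ w w′ (λ n → T 2 (λ m′ → C n m′ l))
          ≈⟨ JJ-cong w w′ (λ n m _ m≤N → C-transportʳ n l m≤N l≤N) ⟩
        JJ w w′ (λ n m → U 2 (C n m) l)
          ≈⟨ JJ-U w w′ 2 l (λ l′ n m → C n m l′) ⟩
        U 2 (F w w′) l ∎

    F-z₃ : ∀ w w′ {l} → l ≤ N →
           F (w ∷ʳ z₃) (w′ ∷ʳ z₃) l ~
             U 3 (F w (w′ ∷ʳ z₃)) l + U 3 (F (w ∷ʳ z₃) w′) l + U 2 (U 2 (U 2 (F w w′))) l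
    F-z₃ w w′ {l} l≤N = begin
      F (w ∷ʳ z₃) (w′ ∷ʳ z₃) l
        ≈⟨ F-∷ʳ-∷ʳ z₃ z₃ l ⟩
      JJ w w′ (λ n m → T 3 (λ n′ → T 3 (λ m′ → C n′ m′ l) m) n)
        ≈⟨ JJ-cong w w′ (λ n m n≤N m≤N → C-transport₃ l n≤N m≤N l≤N) ⟩
      JJ w w′ (λ n m → A n m + B n m + D n m)
        ≈⟨ ~-trans (JJ-+ w w′ (λ n m → A n m + B n m) D) (+-cong (JJ-+ w w′ A B) ~-refl) ⟩
      JJ w w′ A + JJ w w′ B + JJ w w′ D
        ≈⟨ +-cong (+-cong A-sum B-sum) D-sum ⟩
      U 3 (F w (w′ ∷ʳ z₃)) l + U 3 (F (w ∷ʳ z₃) w′) l + U 2 (U 2 (U 2 (F w w′))) l ∎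
      where
      open ~-Reasoning

      A B D : ℕ → ℕ → ℤ
      A n m = U 3 (λ l′ → T 3 (λ m′ → C n m′ l′) m) l
      B n m = U 3 (λ l′ → T 3 (λ n′ → C n′ m l′) n) l
      D n m = U 2 (λ l′ → T 2 (λ n′ → T 2 (λ m′ → C n′ m′ l′) m) n) l

      F-∷ʳ-∷ʳ : ∀ a b l → F (w ∷ʳ a) (w′ ∷ʳ b) l ~
                  JJ w w′ (λ n m → T (weight a) (λ n′ → T (weight b) (λ m′ → C n′ m′ l) m) n)
      F-∷ʳ-∷ʳ a b l = ~-trans (JJ-∷ʳʳ (w ∷ʳ a) w′ b _) (JJ-∷ʳˡ w w′ a _)

      A-sum : JJ w w′ A ~ U 3 (F w (w′ ∷ʳ z₃)) l
      A-sum = ~-trans (JJ-U w w′ 3 l (λ l′ n m → T 3 (λ m′ → C n m′ l′) m))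
        (L-cong (U-linear 3 l≤N) λ l′ _ → ~-sym (JJ-∷ʳʳ w w′ z₃ (λ n m → C n m l′)))

      B-sum : JJ w w′ B ~ U 3 (F (w ∷ʳ z₃) w′) l
      B-sum = ~-trans (JJ-U w w′ 3 l (λ l′ n m → T 3 (λ n′ → C n′ m l′) n))
        (L-cong (U-linear 3 l≤N) λ l′ _ → ~-sym (JJ-∷ʳˡ w w′ z₃ (λ n m → C n m l′)))

      D-sum : JJ w w′ D ~ U 2 (U 2 (U 2 (F w w′))) l
      -- Under `JJ`, the inner double sum is the connected sum of both words extended by `z₂`. The
      -- two rules for `z₂` extract one `U 2` each, which accounts for the cube of `z₂`.
      D-sum = begin
        JJ w w′ D
          ≈⟨ JJ-U w w′ 2 l (λ l′ n m → T 2 (λ n′ → T 2 (λ m′ → C n′ m′ l′) m) n) ⟩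
        U 2 (λ l′ → JJ w w′ (λ n m → T 2 (λ n′ → T 2 (λ m′ → C n′ m′ l′) m) n)) l
          ≈⟨ L-cong (U-linear 2 l≤N) (λ l′ _ → F-∷ʳ-∷ʳ z₂ z₂ l′) ⟨
        U 2 (F (w ∷ʳ z₂) (w′ ∷ʳ z₂)) l
          ≈⟨ L-cong (U-linear 2 l≤N) (λ _ → F-z₂ˡ w (w′ ∷ʳ z₂)) ⟩
        U 2 (U 2 (F w (w′ ∷ʳ z₂))) l
          ≈⟨ L-cong (U-linear 2 l≤N) (λ _ l′≤N → L-cong (U-linear 2 l′≤N) (λ _ → F-z₂ʳ w w′)) ⟩
        U 2 (U 2 (U 2 (F w w′))) l ∎

    -- The cases are those of `star`. The claim covers all l ≤ N, since `U` at l involves its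
    -- argument at every smaller value.
    star-F : ∀ {w w′} (r : Reverse w) (r′ : Reverse w′) {l} → l ≤ N → ⟦ star r r′ ⟧ l ~ F w w′ l
    -- Here `C 0 m l` is `χ m l` by definition, so `F [] w′ l` unfolds to `V w′ l`.
    star-F {_} {w′} [] r′ {l} _ = ~-reflexive (⟦⟧-monomial w′ l)
    star-F {w} (_ ∶ _ ∶ʳ _) [] {l} l≤N =
      ~-trans (~-reflexive (⟦⟧-monomial w l)) (~-sym (F-[]ʳ w l≤N))
    star-F {_} {w′} (w ∶ r ∶ʳ z₂) r′@(_ ∶ _ ∶ʳ _) {l} l≤N = begin
      ⟦ star r r′ ⊠ monomial [ z₂ ] ⟧ l    ≈⟨ ⟦⟧-⊠ (star r r′) [ z₂ ] l≤N ⟩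
      U 2 ⟦ star r r′ ⟧ l                  ≈⟨ L-cong (U-linear 2 l≤N) (λ _ → star-F r r′) ⟩
      U 2 (F w w′) l                       ≈⟨ F-z₂ˡ w w′ l≤N ⟨
      F (w ∷ʳ z₂) w′ l                     ∎
      where open ~-Reasoning
    star-F {w} r@(_ ∶ _ ∶ʳ z₃) (w′ ∶ r′ ∶ʳ z₂) {l} l≤N = begin
      ⟦ star r r′ ⊠ monomial [ z₂ ] ⟧ l    ≈⟨ ⟦⟧-⊠ (star r r′) [ z₂ ] l≤N ⟩
      U 2 ⟦ star r r′ ⟧ l                  ≈⟨ L-cong (U-linear 2 l≤N) (λ _ → star-F r r′) ⟩
      U 2 (F w w′) l                       ≈⟨ F-z₂ʳ w w′ l≤N ⟨
      F w (w′ ∷ʳ z₂) l                     ∎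
      where open ~-Reasoning
    star-F r₃@(w ∶ r ∶ʳ z₃) r′₃@(w′ ∶ r′ ∶ʳ z₃) {l} l≤N = begin
      ⟦ f₁ ⊞ f₂ ⊞ f₃ ⟧ l
        ≡⟨ ≡.trans (⟦⟧-⊞ (f₁ ⊞ f₂) f₃ l) (cong (_+ ⟦ f₃ ⟧ l) (⟦⟧-⊞ f₁ f₂ l)) ⟩
      ⟦ f₁ ⟧ l + ⟦ f₂ ⟧ l + ⟦ f₃ ⟧ l
        ≈⟨ +-cong (+-cong (strip [ z₃ ] r r′₃) (strip [ z₃ ] r₃ r′)) (strip (z₂ ∷ z₂ ∷ z₂ ∷ []) r r′) ⟩
      U 3 (F w (w′ ∷ʳ z₃)) l + U 3 (F (w ∷ʳ z₃) w′) l + U 2 (U 2 (U 2 (F w w′))) l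
        ≈⟨ F-z₃ w w′ l≤N ⟨
      F (w ∷ʳ z₃) (w′ ∷ʳ z₃) l ∎
      where
      open ~-Reasoning
      f₁ f₂ f₃ : 𝓗²³
      f₁ = star r r′₃ ⊠ monomial [ z₃ ]
      f₂ = star r₃ r′ ⊠ monomial [ z₃ ]
      f₃ = star r r′ ⊠ monomial (z₂ ∷ z₂ ∷ z₂ ∷ [])

      strip : ∀ u {v v′} (s : Reverse v) (s′ : Reverse v′) →
              ⟦ star s s′ ⊠ monomial u ⟧ l ~ U* u (F v v′) l
      strip u s s′ = ~-trans (⟦⟧-⊠ (star s s′) u l≤N)
                             (L-cong (U*-linear u l≤N) λ _ → star-F s s′)

    -- Evaluation at l = p - 1 and the reflection m ↦ p - m.

    one : ℕ → ℤ
    one _ = 1ℤ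

    -- The numbers inverted are n + 1 and d + 1, whose sum is p.
    ι-reflect : ∀ n d → suc n ℕ.+ d ≡ N → ι d ~ -1ℤ * ι n
    ι-reflect n d eq =
      combine₃ (- ι d) (σ-unit n n<N) (- ι n) (σ-unit d d<N) (ι n * ι d) sum~0
        (identity (σ n) (σ d) (ι n) (ι d))
      where
      n<N : n < N
      n<N = subst (n <_) eq (ℕ.m≤m+n (suc n) d)

      d<N : d < N
      d<N = subst (d <_) eq (s≤s (ℕ.m≤n+m d n))

      sum~0 : σ n + σ d ~ 0ℤ
      sum~0 = ~-trans (~-reflexive (cong +_ (≡.trans (ℕ.+-suc (suc n) d) (cong suc eq)))) p~0

      identity : ∀ s t a b →
        b - -1ℤ * a ≡ (- b) * (s * a - 1ℤ) + (- a) * (t * b - 1ℤ) + a * b * (s + t - 0ℤ)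
      identity = solve-∀

    -- The substitution l′ = p - n′ carries 0 < l′ ≤ d to n < n′ ≤ N and l′ - 1 to N - n′; each
    -- inverse changes sign. In the induction on d, the last summand on the left is the first one on
    -- the right.
    U-reflect : ∀ k ψ n d → n ℕ.+ d ≡ N → U k ψ d ~ -1ℤ ^ k * T k (λ n′ → ψ (N ∸ n′)) n
    U-reflect k ψ n zero    eq with refl ← ≡.trans (≡.sym (ℕ.+-identityʳ n)) eq =
      ~-reflexive (≡.sym (≡.trans
        (cong (-1ℤ ^ k *_) (ℤ.+-inverseʳ (∑< n (λ j → ι j ^ k * ψ (n ∸ suc j)))))
        (ℤ.*-zeroʳ (-1ℤ ^ k))))
    U-reflect k ψ n (suc d) eq = begin
      U k ψ d + ι d ^ k * ψ d
        ≈⟨ +-cong (U-reflect k ψ (suc n) d eq′) (*-cong ι^k ~-refl) ⟩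
      -1ℤ ^ k * T k ψ′ (suc n) + -1ℤ ^ k * ι n ^ k * ψ d
        ≡⟨ cong (λ e → -1ℤ ^ k * T k ψ′ (suc n) + -1ℤ ^ k * ι n ^ k * ψ e) N∸n ⟨
      -1ℤ ^ k * T k ψ′ (suc n) + -1ℤ ^ k * ι n ^ k * ψ′ (suc n)
        ≡⟨ identity (-1ℤ ^ k) (T k ψ′ (suc n)) (ι n ^ k) (ψ′ (suc n)) ⟩
      -1ℤ ^ k * (ι n ^ k * ψ′ (suc n) + T k ψ′ (suc n))
        ≡⟨ cong (-1ℤ ^ k *_) (∑[]-first n N _) ⟨
      -1ℤ ^ k * T k ψ′ n ∎
      where
      open ~-Reasoning

      ψ′ : ℕ → ℤ
      ψ′ n′ = ψ (N ∸ n′)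

      eq′ : suc n ℕ.+ d ≡ N
      eq′ = ≡.trans (≡.sym (ℕ.+-suc n d)) eq

      N∸n : N ∸ suc n ≡ d
      N∸n = ≡.trans (cong (_∸ suc n) (≡.sym eq′)) (ℕ.m+n∸m≡n (suc n) d)

      ι^k : ι d ^ k ~ -1ℤ ^ k * ι n ^ k
      ι^k = ~-trans (^-cong k (ι-reflect n d eq′)) (~-reflexive (-1*^ (ι n) k))

      identity : ∀ e t a x → e * t + e * a * x ≡ e * (a * x + t)
      identity = solve-∀

    -- By `V-∷ʳ` the last letter of `w` is the outermost sum over l. Reflection makes it an
    -- outermost `T`, thus the first letter of a word, and contributes the sign of its weight.
    V-reflect : ∀ {w} (r : Reverse w) {n} → n ≤ N →
                V w (N ∸ n) ~ -1ℤ ^ wt w * J (reverse w) one n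
    V-reflect [] _ = ~-refl
    V-reflect (w ∶ r ∶ʳ a) {n} n≤N = begin
      V (w ∷ʳ a) (N ∸ n)
        ≈⟨ V-∷ʳ w a (ℕ.m∸n≤m N n) ⟩
      U k (V w) (N ∸ n)
        ≈⟨ U-reflect k (V w) n (N ∸ n) (ℕ.m+[n∸m]≡n n≤N) ⟩
      -1ℤ ^ k * T k (λ n′ → V w (N ∸ n′)) n
        ≈⟨ *-congˡ (-1ℤ ^ k) (L-cong (T-linear k n≤N) λ _ → V-reflect r) ⟩
      -1ℤ ^ k * T k (λ n′ → -1ℤ ^ wt w * J (reverse w) one n′) n
        ≈⟨ *-congˡ (-1ℤ ^ k) (L-* (T-linear k n≤N) (-1ℤ ^ wt w) (J (reverse w) one)) ⟩
      -1ℤ ^ k * (-1ℤ ^ wt w * J (a ∷ reverse w) one n)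
        ≡⟨ ℤ.*-assoc (-1ℤ ^ k) (-1ℤ ^ wt w) _ ⟨
      -1ℤ ^ k * -1ℤ ^ wt w * J (a ∷ reverse w) one n
        ≡⟨ cong₂ (λ e v → e * J v one n)
             (≡.trans (cong (-1ℤ ^_) (wt-∷ʳ w a)) (ℤ.^-distribˡ-+-* -1ℤ k (wt w)))
             (reverse-++ w [ a ]) ⟨
      -1ℤ ^ wt (w ∷ʳ a) * J (reverse (w ∷ʳ a)) one n ∎
      where
      open ~-Reasoning
      k = weight a

    -- By `C-final`, the variables of `w′` are bounded by N - n, where n is the last variable of
    -- `w`. Their reflections exceed n and so continue the chain of `w`, in reversed order.
    F-final : ∀ w w′ → F w w′ N ~ -1ℤ ^ wt w′ * J (w ++ reverse w′) one 0
    F-final w w′ = begin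
      F w w′ N
        ≈⟨ JJ-cong w w′ (λ n m n≤N _ → C-final n m n≤N) ⟩
      J w (λ n → V w′ (N ∸ n)) 0
        ≈⟨ L-cong (J₀-linear w) (λ _ → V-reflect (reverseView w′)) ⟩
      J w (λ n → -1ℤ ^ wt w′ * J (reverse w′) one n) 0
        ≈⟨ L-* (J₀-linear w) (-1ℤ ^ wt w′) (J (reverse w′) one) ⟩
      -1ℤ ^ wt w′ * J w (J (reverse w′) one) 0
        ≡⟨ cong (λ φ → -1ℤ ^ wt w′ * φ 0) (foldr-++ (λ a → T (weight a)) one w (reverse w′)) ⟨
      -1ℤ ^ wt w′ * J (w ++ reverse w′) one 0 ∎
      where open ~-Reasoning

    V-final : ∀ w → V w N ~ J w one 0
    V-final w = L-cong (J₀-linear w) λ _ n≤N → ~-reflexive (χ-≤ n≤N)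

    star-reverse : ∀ w w′ → ⟦ w ⋆ʷ w′ ⟧ N ~ -1ℤ ^ wt w′ * J (w ++ reverse w′) one 0
    star-reverse w w′ = ~-trans (star-F (reverseView w) (reverseView w′) ℕ.≤-refl) (F-final w w′)

  -- Sums over lists.

  ∑∈ : {A : Set} → List A → (A → ℤ) → ℤ
  ∑∈ xs f = foldr _+_ 0ℤ (map f xs)

  module _ {A : Set} where

    ∑∈-++ : ∀ (f : A → ℤ) xs ys → ∑∈ (xs ++ ys) f ≡ ∑∈ xs f + ∑∈ ys f
    ∑∈-++ f []       ys = ≡.sym (ℤ.+-identityˡ _)
    ∑∈-++ f (x ∷ xs) ys = ≡.trans (cong (λ t → f x + t) (∑∈-++ f xs ys))
                                  (≡.sym (ℤ.+-assoc (f x) (∑∈ xs f) (∑∈ ys f)))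

    ∑∈-concatMap : ∀ {B : Set} (f : A → ℤ) (g : B → List A) xs →
                   ∑∈ (concatMap g xs) f ≡ ∑∈ xs (λ x → ∑∈ (g x) f)
    ∑∈-concatMap f g []       = refl
    ∑∈-concatMap f g (x ∷ xs) = ≡.trans (∑∈-++ f (g x) (concatMap g xs))
                                        (cong (λ t → ∑∈ (g x) f + t) (∑∈-concatMap f g xs))

    ∑∈-* : ∀ c (f : A → ℤ) xs → ∑∈ xs (λ x → c * f x) ≡ c * ∑∈ xs f
    ∑∈-* c f []       = ≡.sym (ℤ.*-zeroʳ c)
    ∑∈-* c f (x ∷ xs) = ≡.trans (cong (λ t → c * f x + t) (∑∈-* c f xs))
                                (≡.sym (ℤ.*-distribˡ-+ c (f x) (∑∈ xs f)))

  -- The list ends with b, so the filter keeps the numbers j + 1 with a ≤ j < b. Induction on b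
  -- splits off the last of them.
  ∑∈-range : ∀ {a b} (f : ℕ → ℤ) → a ≤ b →
             ∑∈ (filter (a ℕ.<?_) (upTo (suc b))) f ≡ ∑[ a , b ] (λ j → f (suc j))
  ∑∈-range {a} {b} f a≤b with ℕ.m≤n⇒m<n∨m≡n a≤b
  ... | inj₂ refl = begin
    ∑∈ (filter (a ℕ.<?_) (upTo (suc a))) f
      ≡⟨ cong (λ xs → ∑∈ xs f) (filter-none (a ℕ.<?_)
           (All.map (λ n<1+a → ℕ.≤⇒≯ (ℕ.≤-pred n<1+a)) (all-upTo (suc a)))) ⟩
    0ℤ
      ≡⟨ ℤ.+-inverseʳ (∑< a (λ j → f (suc j))) ⟨
    ∑[ a , a ] (λ j → f (suc j)) ∎
    where open ≡.≡-Reasoning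
  ∑∈-range {a} {suc b} f _ | inj₁ a<b = begin
    ∑∈ (filter (a ℕ.<?_) (upTo (suc (suc b)))) f
      ≡⟨ cong (λ xs → ∑∈ (filter (a ℕ.<?_) xs) f) (upTo-∷ʳ (suc b)) ⟨
    ∑∈ (filter (a ℕ.<?_) (upTo (suc b) ∷ʳ suc b)) f
      ≡⟨ cong (λ xs → ∑∈ xs f) (≡.trans (filter-++ (a ℕ.<?_) (upTo (suc b)) [ suc b ])
           (cong (filter (a ℕ.<?_) (upTo (suc b)) ++_) (filter-accept (a ℕ.<?_) a<b))) ⟩
    ∑∈ (filter (a ℕ.<?_) (upTo (suc b)) ++ [ suc b ]) f
      ≡⟨ ∑∈-++ f (filter (a ℕ.<?_) (upTo (suc b))) [ suc b ] ⟩
    ∑∈ (filter (a ℕ.<?_) (upTo (suc b))) f + (f (suc b) + 0ℤ)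
      ≡⟨ cong (_+ (f (suc b) + 0ℤ)) (∑∈-range f (ℕ.≤-pred a<b)) ⟩
    ∑[ a , b ] (λ j → f (suc j)) + (f (suc b) + 0ℤ)
      ≡⟨ identity (∑< b (λ j → f (suc j))) (∑< a (λ j → f (suc j))) (f (suc b)) ⟩
    ∑[ a , suc b ] (λ j → f (suc j)) ∎
    where
    open ≡.≡-Reasoning
    identity : ∀ x y z → x - y + (z + 0ℤ) ≡ x + z - y
    identity = solve-∀

  -- Coprimality of products and powers.

  coprime-* : ∀ {m n k} → Coprime m k → Coprime n k → Coprime (m ℕ.* n) k
  coprime-* m⊥k n⊥k {d} (d∣mn , d∣k) =
    n⊥k (coprime-divisor (λ (e∣d , e∣m) → m⊥k (e∣m , ∣-trans e∣d d∣k)) d∣mn , d∣k)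

  coprime-^ : ∀ {m k} e → Coprime m k → Coprime (m ℕ.^ e) k
  coprime-^ {k = k} zero    _   = 1-coprimeTo k
  coprime-^ {m}     (suc e) m⊥k = coprime-* {m} m⊥k (coprime-^ e m⊥k)

  -- Finite multiple zeta values at a prime as iterated sums.

  module HarmonicSums (N : ℕ) (prime : Prime (suc N)) where

    open Congruence (suc N)

    private
      p : ℕ
      p = suc N

    recip-unit : ∀ {n} → Coprime n p → + n * recip p n ~ 1ℤ
    recip-unit n⊥p = ⌊ recip-correct n⊥p ⌋

    ι : ℕ → ℤ
    ι j = recip p (suc j)

    suc-coprime : ∀ {j} → j < N → Coprime (suc j) p
    suc-coprime j<N = Coprime.sym (prime⇒coprime prime (s≤s j<N))

    σ-unit : ∀ j → j < N → σ j * ι j ~ 1ℤ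
    σ-unit j j<N = recip-unit (suc-coprime j<N)

    open Operators N ι
    open ConnectedSums N ι σ-unit

    -- Both sides are inverses of mn modulo p, and inverses are unique modulo p.
    recip-* : ∀ {m n} → Coprime m p → Coprime n p → recip p (m ℕ.* n) ~ recip p m * recip p n
    recip-* {m} {n} m⊥p n⊥p =
      combine₃ (u * v) (recip-unit {m ℕ.* n} (coprime-* {m} m⊥p n⊥p))
               (- (r * (+ n * v))) (recip-unit m⊥p) (- r) (recip-unit n⊥p)
               (≡.trans (identity (+ m) (+ n) u v r)
                  (cong (λ t → u * v * (t * r - 1ℤ) + (- (r * (+ n * v))) * (+ m * u - 1ℤ)
                                 + (- r) * (+ n * v - 1ℤ)) (≡.sym (ℤ.pos-* m n))))
      where
      u = recip p m
      v = recip p n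
      r = recip p (m ℕ.* n)
      identity : ∀ x y u v r → r - u * v ≡
        u * v * (x * y * r - 1ℤ) + (- (r * (y * v))) * (x * u - 1ℤ) + (- r) * (y * v - 1ℤ)
      identity = solve-∀

    recip-^ : ∀ {n} k → Coprime n p → recip p (n ℕ.^ k) ~ recip p n ^ k
    recip-^ zero    _   = ~-trans (~-reflexive (≡.sym (ℤ.*-identityˡ (recip p 1))))
                                  (recip-unit (1-coprimeTo p))
    recip-^ {n} (suc k) n⊥p = ~-trans (recip-* {n} n⊥p (coprime-^ k n⊥p))
                                      (*-congˡ (recip p n) (recip-^ k n⊥p))

    ∑∈-cong : {A : Set} {f g : A → ℤ} {xs : List A} → All (λ x → f x ~ g x) xs → ∑∈ xs f ~ ∑∈ xs g
    ∑∈-cong []         = ~-refl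
    ∑∈-cong (px ∷ pxs) = +-cong px (∑∈-cong pxs)

    -- Allows `recip-*` to be applied to denominators. Every entry n satisfies a < n < p, so it is a
    -- successor below the prime.
    denominators-coprime : ∀ w a → All (λ ns → Coprime (denominator w ns) p) (increasing a p (length w))
    denominators-coprime []      a = 1-coprimeTo p ∷ []
    denominators-coprime (x ∷ w) a =
      concat⁺ (map⁺ (All.zipWith (λ {n} → extend n)
        (all-filter (a ℕ.<?_) (upTo p) , filter⁺ (a ℕ.<?_) (all-upTo p))))
      where
      extend : ∀ n → a < n × n < p →
               All (λ ns → Coprime (denominator (x ∷ w) ns) p) (map (n ∷_) (increasing n p (length w)))
      extend (suc j) (_ , s≤s j<N) = map⁺ (All.map
        (coprime-* {suc j ℕ.^ index x} (coprime-^ (index x) (suc-coprime j<N)))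
        (denominators-coprime w (suc j)))

    -- Splitting the index vectors by their first entry n gives the outermost `T`. The lower bound
    -- is general because the remaining entries start above n.
    ∑-increasing : ∀ w {a} → a ≤ N →
                   ∑∈ (increasing a p (length w)) (λ ns → recip p (denominator w ns))
                     ~ foldr (λ x → T (index x)) one w a
    ∑-increasing [] _ = ~-trans (~-reflexive (ℤ.+-identityʳ (recip p 1))) (recip-^ {1} 0 (1-coprimeTo p))
    ∑-increasing (x ∷ w) {a} a≤N = begin
      ∑∈ (increasing a p (suc (length w))) (λ ns → recip p (denominator (x ∷ w) ns))
        ≡⟨ ∑∈-concatMap _ (λ n → map (n ∷_) (increasing n p (length w))) (filter (a ℕ.<?_) (upTo p)) ⟩
      ∑∈ (filter (a ℕ.<?_) (upTo p)) (λ n →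
        ∑∈ (map (n ∷_) (increasing n p (length w))) (λ ns → recip p (denominator (x ∷ w) ns)))
        ≡⟨ ∑∈-range _ a≤N ⟩
      ∑[ a , N ] (λ j →
        ∑∈ (map (suc j ∷_) (increasing (suc j) p (length w))) (λ ns → recip p (denominator (x ∷ w) ns)))
        ≈⟨ ∑[]-cong a≤N first ⟩
      T (index x) (foldr (λ x → T (index x)) one w) a ∎
      where
      open ~-Reasoning
      k = index x

      first : ∀ j → j < N →
        ∑∈ (map (suc j ∷_) (increasing (suc j) p (length w))) (λ ns → recip p (denominator (x ∷ w) ns))
          ~ ι j ^ k * foldr (λ x → T (index x)) one w (suc j)
      first j j<N = begin
        ∑∈ (map (suc j ∷_) (increasing (suc j) p (length w))) (λ ns → recip p (denominator (x ∷ w) ns))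
          ≡⟨ cong (foldr _+_ 0ℤ) (map-∘ (increasing (suc j) p (length w))) ⟨
        ∑∈ (increasing (suc j) p (length w)) (λ ns → recip p (suc j ℕ.^ k ℕ.* denominator w ns))
          ≈⟨ ∑∈-cong (All.map (λ {ns} → split ns) (denominators-coprime w (suc j))) ⟩
        ∑∈ (increasing (suc j) p (length w)) (λ ns → ι j ^ k * recip p (denominator w ns))
          ≡⟨ ∑∈-* (ι j ^ k) _ (increasing (suc j) p (length w)) ⟩
        ι j ^ k * ∑∈ (increasing (suc j) p (length w)) (λ ns → recip p (denominator w ns))
          ≈⟨ *-congˡ (ι j ^ k) (∑-increasing w j<N) ⟩
        ι j ^ k * foldr (λ x → T (index x)) one w (suc j) ∎
        where
        split : ∀ ns → Coprime (denominator w ns) p →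
                recip p (suc j ℕ.^ k ℕ.* denominator w ns) ~ ι j ^ k * recip p (denominator w ns)
        split ns ns⊥p = ~-trans (recip-* {suc j ℕ.^ k} (coprime-^ k (suc-coprime j<N)) ns⊥p)
                                (*-cong (recip-^ k (suc-coprime j<N)) ~-refl)

    ζₚ-J : ∀ w → ζₚ p (map letter w) ~ J w one 0
    ζₚ-J w = ~-trans (∑-increasing (map letter w) z≤n)
                     (~-reflexive (cong (λ φ → φ 0) (foldr-map (λ x → T (index x)) letter one w)))

    Z𝒜-⟦⟧ : ∀ f → Z𝒜 (inclusion f) p prime ~ ⟦ f ⟧ N
    Z𝒜-⟦⟧ []            = ~-refl
    Z𝒜-⟦⟧ ((c , w) ∷ f) =
      +-cong (*-congˡ c (~-trans (ζₚ-J w) (~-sym (V-final w)))) (Z𝒜-⟦⟧ f)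

    ζₚ-star : ∀ w₁ w₂ → -1ℤ ^ wt w₂ * Z𝒜 (inclusion (monomial (w₁ ++ reverse w₂))) p prime
                          ~ Z𝒜 (inclusion (monomial w₁ ⋆ monomial w₂)) p prime
    ζₚ-star w₁ w₂ = begin
      -1ℤ ^ wt w₂ * Z𝒜 (inclusion (monomial w)) p prime
        ≈⟨ *-congˡ (-1ℤ ^ wt w₂) (Z𝒜-⟦⟧ (monomial w)) ⟩
      -1ℤ ^ wt w₂ * ⟦ monomial w ⟧ N
        ≈⟨ *-congˡ (-1ℤ ^ wt w₂) (~-trans (~-reflexive (⟦⟧-monomial w N)) (V-final w)) ⟩
      -1ℤ ^ wt w₂ * J w one 0
        ≈⟨ star-reverse w₁ w₂ ⟨
      ⟦ w₁ ⋆ʷ w₂ ⟧ N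
        ≈⟨ Z𝒜-⟦⟧ (w₁ ⋆ʷ w₂) ⟨
      Z𝒜 (inclusion (w₁ ⋆ʷ w₂)) p prime
        ≡⟨ cong (λ f → Z𝒜 (inclusion f) p prime) (⋆-monomial w₁ w₂) ⟨
      Z𝒜 (inclusion (monomial w₁ ⋆ monomial w₂)) p prime ∎
      where
      open ~-Reasoning
      w = w₁ ++ reverse w₂

-- Passage from single primes to the ring of families.

open Development using (module Congruence; module HarmonicSums)

open import Algebra.Properties.Semiring.Exp (CommutativeRing.semiring 𝒜) using (_^_)
open CommutativeRing 𝒜 using (_*_; -_; 1#)

-1^-component : ∀ k p (pr : Prime p) → ((- 1#) ^ k) p pr ≡ -1ℤ ℤ.^ k
-1^-component zero    p pr = refl
-1^-component (suc k) p pr = cong (-1ℤ ℤ.*_) (-1^-component k p pr)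

corollary1p5 : (w₁ w₂ : Word Letter₂₃) → (- 1#) ^ wt w₂ * Z𝒜 (inclusion (monomial (w₁ ++ reverse w₂))) ≈ Z𝒜 (inclusion (monomial w₁ ⋆ monomial w₂))
-- The congruence holds at every prime, hence the bound 0.
corollary1p5 w₁ w₂ = 0 , λ where
  zero    pr _ → contradiction pr ¬prime[0]
  (suc N) pr _ →
    let open Congruence (suc N)
        Z = Z𝒜 (inclusion (monomial (w₁ ++ reverse w₂))) (suc N) pr
    in congruent (~-trans (~-reflexive (cong (ℤ._* Z) (-1^-component (wt w₂) (suc N) pr)))
                          (HarmonicSums.ζₚ-star N pr w₁ w₂))
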